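{- Let $G$ be a connected graph with $|V(G)|=m$, let $x,y$ be two distinct vertices of $G$, let $n\ge 3$, and let $F_n(G)=F_n(G,x,y)$ be the generalized flower graph. Let $Kf(\cdot)$ denote the Kirchhoff index. Then $$n\,Kf(G)-\frac{m(m-1)\,r_G(x,y)}{2}\ \le\ Kf(F_n(G))\ \le\ Kf(G)\,\bigl(n+nm(n-1)\bigr)+\frac{r_G(x,y)\,(n^3-n^2)\,m^2}{4}.$$
   Context: For a connected graph $H$ with vertex set $\{1,\dots,N\}$ and Laplacian matrix $L$, the resistance distance between vertices $i,j$ is $r_H(i,j)=(e_i-e_j)^T L^\dagger (e_i-e_j)$, where $e_i$ is the $i$th standard unit vector and $L^\dagger$ is the Moore–Penrose pseudoinverse of $L$. The Kirchhoff index is $Kf(H)=\frac12\sum_{i,j\in V(H)} r_H(i,j)$ (sum over ordered pairs). Generalized flower graph: let $G$ be a graph, $x\ne y$ two vertices of $G$, and $n\ge 3$. $F_n(G,x,y)$ (written $F_n(G)$) is the graph obtained by taking $n$ vertex-disjoint copies $G_1,\dots,G_n$ of $G$ (the petals), with $x_i,y_i$ the copies of $x,y$ in $G_i$, and identifying $y_i$ with $x_{i+1}$ for $1\le i<n$ and $y_n$ with $x_1$. -}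

module Defs where

open import Data.Bool.Base using (if_then_else_)
open import Data.Fin.Base using (Fin; zero; suc; toℕ; combine; punchIn; punchOut)
open import Data.Fin.Properties
  using (_≟_; any?; combine-injective; combine-surjective; punchOut-injective; punchOut-cong;
         punchInᵢ≢i; punchOut-punchIn; toℕ<n; toℕ-injective; toℕ-fromℕ<)
open import Data.Integer.Base as ℤ using ()
open import Data.Nat.Base as ℕ using (ℕ; zero; suc; pred; s≤s)
import Data.Nat.DivMod as ℕ
import Data.Nat.Properties as ℕ
open import Data.Product.Base using (∃; _×_; _,_; proj₁; proj₂)
open import Data.Rational.Base
  using (ℚ; 0ℚ; 1ℚ; ½; _+_; _*_; _-_; -_; 1/_; _/_; _≤_;
         ≢-nonZero; nonNegative; nonPositive)
import Data.Rational.Properties as ℚ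
open import Data.Rational.Solver using (module +-*-Solver)
open import Data.Sum.Base using (_⊎_; inj₁; inj₂)
open import Data.Vec.Functional using (Vector)
open import Level using (0ℓ)
open import Relation.Binary.Construct.Closure.ReflexiveTransitive using (Star)
open import Relation.Binary.Core using (Rel)
open import Relation.Binary.Definitions using (Decidable; Symmetric; Irreflexive)
open import Relation.Binary.PropositionalEquality
open import Relation.Nullary.Decidable using (does; yes; no; _×-dec_)
open import Relation.Nullary.Negation using (contradiction)

open import Algebra.Bundles using (CommutativeRing)
open import Algebra.Properties.Semiring.Sum (CommutativeRing.semiring ℚ.+-*-commutativeRing)
  using (sum; sum-syntax; sum-cong-≗; ∑-distrib-+; ∑-comm; *-distribˡ-sum; *-distribʳ-sum)

open ≡-Reasoning

fromℕ : ℕ → ℚ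
fromℕ n = ℤ.+ n / 1

------------------------------------------------------------------------
-- Graphs

record Graph (m : ℕ) : Set₁ where
  field
    Adj        : Rel (Fin m) 0ℓ
    adj?       : Decidable Adj
    adj-sym    : Symmetric Adj
    adj-irrefl : Irreflexive _≡_ Adj

Connected : ∀ {m} → Graph m → Set
Connected G = ∀ u v → Star (Graph.Adj G) u v

------------------------------------------------------------------------
-- Matrices and the Moore–Penrose pseudoinverse
--
-- The pseudoinverse of a rational matrix is rational, and its defining
-- equations determine it uniquely over ℝ, so nothing is lost by working
-- over ℚ.

Matrix : ℕ → ℕ → Set
Matrix m n = Fin m → Fin n → ℚ

infixl 9 _⊗_

_⊗_ : ∀ {m n p} → Matrix m n → Matrix n p → Matrix m p
_⊗_ {n = n} A B i j = ∑[ k < n ] (A i k * B k j)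

record IsMoorePenrose {m n} (A : Matrix m n) (X : Matrix n m) : Set where
  field
    AXA   : ∀ i j → (A ⊗ X ⊗ A) i j ≡ A i j
    XAX   : ∀ i j → (X ⊗ A ⊗ X) i j ≡ X i j
    AXsym : ∀ i j → (A ⊗ X) i j ≡ (A ⊗ X) j i
    XAsym : ∀ i j → (X ⊗ A) i j ≡ (X ⊗ A) j i

private

  infix 8 _∙_
  _∙_ : ∀ {n} → Vector ℚ n → Vector ℚ n → ℚ
  _∙_ {n} u v = ∑[ k < n ] (u k * v k)

  col : ∀ {m n} → Matrix m n → Fin n → Vector ℚ m
  col A j i = A i j

  ∙-congˡ : ∀ {n} {u u′ : Vector ℚ n} v → (∀ k → u k ≡ u′ k) → u ∙ v ≡ u′ ∙ v
  ∙-congˡ v eq = sum-cong-≗ λ k → cong (_* v k) (eq k)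

  ∙-congʳ : ∀ {n} (u : Vector ℚ n) {v v′} → (∀ k → v k ≡ v′ k) → u ∙ v ≡ u ∙ v′
  ∙-congʳ u eq = sum-cong-≗ λ k → cong (u k *_) (eq k)

  ∙-comm : ∀ {n} (u v : Vector ℚ n) → u ∙ v ≡ v ∙ u
  ∙-comm u v = sum-cong-≗ λ k → ℚ.*-comm (u k) (v k)

  ∙-+ : ∀ {n} (u v w : Vector ℚ n) → u ∙ (λ k → v k + w k) ≡ u ∙ v + u ∙ w
  ∙-+ u v w = trans (sum-cong-≗ λ k → ℚ.*-distribˡ-+ (u k) (v k) (w k))
                    (∑-distrib-+ (λ k → u k * v k) (λ k → u k * w k))

  ∙-* : ∀ {n} (u v : Vector ℚ n) s → u ∙ (λ k → v k * s) ≡ u ∙ v * s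
  ∙-* u v s = trans (sum-cong-≗ λ k → sym (ℚ.*-assoc (u k) (v k) s))
                    (sym (*-distribʳ-sum s (λ k → u k * v k)))

  ∙-- : ∀ {n} (u v w : Vector ℚ n) → u ∙ (λ k → v k - w k) ≡ u ∙ v - u ∙ w
  ∙-- u v w = begin
    u ∙ (λ k → v k - w k)            ≡⟨ ∙-congʳ u (λ k → cong (v k +_) (neg (w k))) ⟩
    u ∙ (λ k → v k + w k * (- 1ℚ))   ≡⟨ ∙-+ u v _ ⟩
    u ∙ v + u ∙ (λ k → w k * (- 1ℚ)) ≡⟨ cong (u ∙ v +_) (∙-* u w (- 1ℚ)) ⟩
    u ∙ v + u ∙ w * (- 1ℚ)           ≡⟨ cong (u ∙ v +_) (sym (neg (u ∙ w))) ⟩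
    u ∙ v - u ∙ w                    ∎
    where
    neg : ∀ p → - p ≡ p * (- 1ℚ)
    neg = solve 1 (λ p → :- p := p :* (:- con 1ℚ)) refl where open +-*-Solver

  *-∙ : ∀ {n} s (u v : Vector ℚ n) → (λ k → s * u k) ∙ v ≡ s * (u ∙ v)
  *-∙ s u v = trans (sum-cong-≗ λ k → ℚ.*-assoc s (u k) (v k))
                    (sym (*-distribˡ-sum s (λ k → u k * v k)))

  ∙-assoc : ∀ {m n} (u : Vector ℚ m) (M : Matrix m n) (v : Vector ℚ n) →
            (λ k → u ∙ col M k) ∙ v ≡ u ∙ (λ l → M l ∙ v)
  ∙-assoc {m} {n} u M v = begin
    (∑[ k < n ] (u ∙ col M k * v k))
      ≡⟨ sum-cong-≗ (λ k → *-distribʳ-sum (v k) (λ l → u l * M l k)) ⟩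
    (∑[ k < n ] ∑[ l < m ] (u l * M l k * v k))
      ≡⟨ ∑-comm (λ k l → u l * M l k * v k) ⟩
    (∑[ l < m ] ∑[ k < n ] (u l * M l k * v k))
      ≡⟨ sum-cong-≗ (λ l → trans (sum-cong-≗ λ k → ℚ.*-assoc (u l) (M l k) (v k))
                                 (sym (*-distribˡ-sum (u l) (λ k → M l k * v k)))) ⟩
    (∑[ l < m ] (u l * (M l ∙ v))) ∎

  0≤p² : ∀ p → 0ℚ ≤ p * p
  0≤p² p with ℚ.≤-total 0ℚ p
  ... | inj₁ 0≤p = subst (_≤ p * p) (ℚ.*-zeroʳ p)
                     (ℚ.*-monoˡ-≤-nonNeg p {{nonNegative 0≤p}} 0≤p)
  ... | inj₂ p≤0 = subst (_≤ p * p) (ℚ.*-zeroʳ p)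
                     (ℚ.*-monoˡ-≤-nonPos p {{nonPositive p≤0}} p≤0)

  0≤u∙u : ∀ {n} (u : Vector ℚ n) → 0ℚ ≤ u ∙ u
  0≤u∙u {zero}  u = ℚ.≤-refl
  0≤u∙u {suc n} u = ℚ.+-mono-≤ (0≤p² (u zero)) (0≤u∙u (λ k → u (suc k)))

  p²≡0⇒p≡0 : ∀ p → p * p ≡ 0ℚ → p ≡ 0ℚ
  p²≡0⇒p≡0 p eq with p ℚ.≟ 0ℚ
  ... | yes p≡0 = p≡0
  ... | no  p≢0 = begin
    p              ≡⟨ ℚ.*-identityˡ p ⟨
    1ℚ * p         ≡⟨ cong (_* p) (sym (ℚ.*-inverseˡ p)) ⟩
    1/ p * p * p   ≡⟨ ℚ.*-assoc (1/ p) p p ⟩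
    1/ p * (p * p) ≡⟨ cong (1/ p *_) eq ⟩
    1/ p * 0ℚ      ≡⟨ ℚ.*-zeroʳ (1/ p) ⟩
    0ℚ             ∎
    where instance _ = ≢-nonZero p≢0

  +-zero : ∀ {p q} → 0ℚ ≤ p → 0ℚ ≤ q → p + q ≡ 0ℚ → p ≡ 0ℚ × q ≡ 0ℚ
  +-zero {p} {q} 0≤p 0≤q eq =
    ℚ.≤-antisym (subst₂ _≤_ (ℚ.+-identityʳ p) eq (ℚ.+-monoʳ-≤ p 0≤q)) 0≤p ,
    ℚ.≤-antisym (subst₂ _≤_ (ℚ.+-identityˡ q) eq (ℚ.+-monoˡ-≤ q 0≤p)) 0≤q

  u∙u≡0⇒u≡0 : ∀ {n} (u : Vector ℚ n) → u ∙ u ≡ 0ℚ → ∀ k → u k ≡ 0ℚ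
  u∙u≡0⇒u≡0 {suc n} u eq k
    with z , s ← +-zero (0≤p² (u zero)) (0≤u∙u (λ l → u (suc l))) eq
    with k
  ... | zero  = p²≡0⇒p≡0 (u zero) z
  ... | suc l = u∙u≡0⇒u≡0 (λ l → u (suc l)) s l

  1+u∙u≢0 : ∀ {n} (u : Vector ℚ n) → 1ℚ + u ∙ u ≢ 0ℚ
  1+u∙u≢0 u eq
    with () ← proj₁ (+-zero {1ℚ} (ℚ.nonNegative⁻¹ 1ℚ) (0≤u∙u u) eq)

  -- One step of Greville's recursion: from a pseudoinverse X of B, obtain
  -- one of the matrix whose first column is a and whose other columns
  -- are those of B.

  module Greville {m n} (A : Matrix m (suc n)) (X : Matrix n m)
                  (mp : IsMoorePenrose (λ i j → A i (suc j)) X) where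
    open IsMoorePenrose mp

    a : Vector ℚ m
    a i = A i zero

    B : Matrix m n
    B i j = A i (suc j)

    d : Vector ℚ n
    d k = X k ∙ a

    Bd : Vector ℚ m
    Bd i = B i ∙ d

    c : Vector ℚ m
    c i = a i - Bd i

    BXa : ∀ i → (B ⊗ X) i ∙ a ≡ Bd i
    BXa i = ∙-assoc (B i) X a

    XBd : ∀ k → (X ⊗ B) k ∙ d ≡ d k
    XBd k = begin
      (X ⊗ B) k ∙ d                 ≡⟨ ∙-assoc ((X ⊗ B) k) X a ⟨
      (X ⊗ B ⊗ X) k ∙ a             ≡⟨ ∙-congˡ a (XAX k) ⟩
      d k                           ∎

    dXB : ∀ j → d ∙ col (X ⊗ B) j ≡ d j
    dXB j = begin
      d ∙ col (X ⊗ B) j  ≡⟨ ∙-congʳ d (λ k → XAsym k j) ⟩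
      d ∙ (X ⊗ B) j      ≡⟨ ∙-comm d _ ⟩
      (X ⊗ B) j ∙ d      ≡⟨ XBd j ⟩
      d j                ∎

    Xc : ∀ k → X k ∙ c ≡ 0ℚ
    Xc k = begin
      X k ∙ c                 ≡⟨ ∙-- (X k) a Bd ⟩
      d k - X k ∙ Bd          ≡⟨ cong (λ z → d k - z) (sym (∙-assoc (X k) B d)) ⟩
      d k - (X ⊗ B) k ∙ d     ≡⟨ cong (λ z → d k - z) (XBd k) ⟩
      d k - d k               ≡⟨ ℚ.+-inverseʳ (d k) ⟩
      0ℚ                      ∎

    cB : ∀ j → c ∙ col B j ≡ 0ℚ
    cB j = begin
      c ∙ col B j                       ≡⟨ ∙-comm c (col B j) ⟩
      col B j ∙ c                       ≡⟨ ∙-- (col B j) a Bd ⟩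
      col B j ∙ a - col B j ∙ Bd        ≡⟨ cong (λ z → col B j ∙ a - z) lem ⟩
      col B j ∙ a - col B j ∙ a         ≡⟨ ℚ.+-inverseʳ (col B j ∙ a) ⟩
      0ℚ                                ∎
      where
      lem : col B j ∙ Bd ≡ col B j ∙ a
      lem = begin
        col B j ∙ Bd                              ≡⟨ ∙-congʳ (col B j) (λ i → sym (BXa i)) ⟩
        col B j ∙ (λ i → (B ⊗ X) i ∙ a)           ≡⟨ ∙-assoc (col B j) (B ⊗ X) a ⟨
        (λ i → col B j ∙ col (B ⊗ X) i) ∙ a       ≡⟨ ∙-congˡ a (λ i →
            trans (∙-comm (col B j) _) (∙-congˡ (col B j) (λ l → AXsym l i))) ⟩
        (λ i → (B ⊗ X ⊗ B) i j) ∙ a               ≡⟨ ∙-congˡ a (λ i → AXA i j) ⟩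
        col B j ∙ a                               ∎

    module Step
      (b : Vector ℚ m)
      (cb-sym : ∀ i j → c i * b j ≡ c j * b i)
      (bB : ∀ j → b ∙ col B j ≡ d j * (1ℚ - b ∙ a))
      (cβ : ∀ i → c i * (b ∙ a) ≡ c i)
      (bP : ∀ j → b ∙ (λ i → (B ⊗ X) i j + c i * b j) ≡ b j)
      where
      open +-*-Solver

      β : ℚ
      β = b ∙ a

      Y : Matrix (suc n) m
      Y zero    j = b j
      Y (suc k) j = X k j - d k * b j

      P : ∀ i j → (A ⊗ Y) i j ≡ (B ⊗ X) i j + c i * b j
      P i j = begin
        a i * b j + B i ∙ (λ k → X k j - d k * b j)
          ≡⟨ cong (a i * b j +_) (∙-- (B i) (col X j) (λ k → d k * b j)) ⟩
        a i * b j + ((B ⊗ X) i j - B i ∙ (λ k → d k * b j))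
          ≡⟨ cong (λ z → a i * b j + ((B ⊗ X) i j - z)) (∙-* (B i) d (b j)) ⟩
        a i * b j + ((B ⊗ X) i j - Bd i * b j)
          ≡⟨ solve 4 (λ p q r s → p :* q :+ (r :- s :* q) := r :+ (p :- s) :* q) refl
               (a i) (b j) ((B ⊗ X) i j) (Bd i) ⟩
        (B ⊗ X) i j + c i * b j ∎

      row : ∀ k (v : Vector ℚ m) → Y (suc k) ∙ v ≡ X k ∙ v - d k * (b ∙ v)
      row k v = begin
        Y (suc k) ∙ v                      ≡⟨ ∙-comm (Y (suc k)) v ⟩
        v ∙ Y (suc k)                      ≡⟨ ∙-- v (X k) (λ j → d k * b j) ⟩
        v ∙ X k - v ∙ (λ j → d k * b j)    ≡⟨ cong₂ _-_ (∙-comm v (X k)) (∙-comm v (λ j → d k * b j)) ⟩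
        X k ∙ v - (λ j → d k * b j) ∙ v    ≡⟨ cong (λ z → X k ∙ v - z) (*-∙ (d k) b v) ⟩
        X k ∙ v - d k * (b ∙ v)            ∎

      Y-AXsym : ∀ i j → (A ⊗ Y) i j ≡ (A ⊗ Y) j i
      Y-AXsym i j = begin
        (A ⊗ Y) i j              ≡⟨ P i j ⟩
        (B ⊗ X) i j + c i * b j  ≡⟨ cong₂ _+_ (AXsym i j) (cb-sym i j) ⟩
        (B ⊗ X) j i + c j * b i  ≡⟨ P j i ⟨
        (A ⊗ Y) j i              ∎

      Q₁ : ∀ k → (Y ⊗ A) (suc k) zero ≡ d k * (1ℚ - β)
      Q₁ k = trans (row k a)
        (solve 2 (λ p q → p :- p :* q := p :* (con 1ℚ :- q)) refl (d k) β)

      Q₂ : ∀ k j → (Y ⊗ A) (suc k) (suc j) ≡ (X ⊗ B) k j - d k * (d j * (1ℚ - β))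
      Q₂ k j = trans (row k (col B j)) (cong (λ z → (X ⊗ B) k j - d k * z) (bB j))

      Y-XAsym : ∀ i j → (Y ⊗ A) i j ≡ (Y ⊗ A) j i
      Y-XAsym zero    zero    = refl
      Y-XAsym zero    (suc j) = trans (bB j) (sym (Q₁ j))
      Y-XAsym (suc i) zero    = trans (Q₁ i) (sym (bB i))
      Y-XAsym (suc i) (suc j) = begin
        (Y ⊗ A) (suc i) (suc j)                   ≡⟨ Q₂ i j ⟩
        (X ⊗ B) i j - d i * (d j * (1ℚ - β))      ≡⟨ cong₂ _-_ (XAsym i j)
          (solve 3 (λ p q r → p :* (q :* r) := q :* (p :* r)) refl (d i) (d j) (1ℚ - β)) ⟩
        (X ⊗ B) j i - d j * (d i * (1ℚ - β))      ≡⟨ Q₂ j i ⟨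
        (Y ⊗ A) (suc j) (suc i)                   ∎

      AYv : ∀ i (v : Vector ℚ m) → (A ⊗ Y) i ∙ v ≡ (B ⊗ X) i ∙ v + c i * (b ∙ v)
      AYv i v = begin
        (A ⊗ Y) i ∙ v                                ≡⟨ ∙-congˡ v (P i) ⟩
        (λ j → (B ⊗ X) i j + c i * b j) ∙ v          ≡⟨ ∙-comm _ v ⟩
        v ∙ (λ j → (B ⊗ X) i j + c i * b j)          ≡⟨ ∙-+ v ((B ⊗ X) i) (λ j → c i * b j) ⟩
        v ∙ (B ⊗ X) i + v ∙ (λ j → c i * b j)        ≡⟨ cong₂ _+_ (∙-comm v _) (∙-comm v _) ⟩
        (B ⊗ X) i ∙ v + (λ j → c i * b j) ∙ v        ≡⟨ cong ((B ⊗ X) i ∙ v +_) (*-∙ (c i) b v) ⟩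
        (B ⊗ X) i ∙ v + c i * (b ∙ v)                ∎

      Y-AXA : ∀ i j → (A ⊗ Y ⊗ A) i j ≡ A i j
      Y-AXA i zero = begin
        (A ⊗ Y) i ∙ a                  ≡⟨ AYv i a ⟩
        (B ⊗ X) i ∙ a + c i * β        ≡⟨ cong₂ _+_ (BXa i) (cβ i) ⟩
        Bd i + (a i - Bd i)            ≡⟨ solve 2 (λ p q → p :+ (q :- p) := q) refl (Bd i) (a i) ⟩
        a i                            ∎
      Y-AXA i (suc j) = begin
        (A ⊗ Y) i ∙ col B j                        ≡⟨ AYv i (col B j) ⟩
        (B ⊗ X) i ∙ col B j + c i * (b ∙ col B j)  ≡⟨ cong₂ _+_ (AXA i j) (cong (c i *_) (bB j)) ⟩
        B i j + c i * (d j * (1ℚ - β))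
          ≡⟨ solve 4 (λ p q r s → p :+ q :* (r :* (con 1ℚ :- s)) := p :+ r :* (q :- q :* s)) refl
               (B i j) (c i) (d j) β ⟩
        B i j + d j * (c i - c i * β)              ≡⟨ cong (λ z → B i j + d j * (c i - z)) (cβ i) ⟩
        B i j + d j * (c i - c i)
          ≡⟨ solve 3 (λ p q r → p :+ q :* (r :- r) := p) refl (B i j) (d j) (c i) ⟩
        B i j                                      ∎

      bAY : ∀ j → b ∙ col (A ⊗ Y) j ≡ b j
      bAY j = trans (∙-congʳ b (λ i → P i j)) (bP j)

      XAY : ∀ k j → X k ∙ col (A ⊗ Y) j ≡ X k j
      XAY k j = begin
        X k ∙ col (A ⊗ Y) j                          ≡⟨ ∙-congʳ (X k) (λ i → P i j) ⟩
        X k ∙ (λ i → (B ⊗ X) i j + c i * b j)        ≡⟨ ∙-+ (X k) (col (B ⊗ X) j) (λ i → c i * b j) ⟩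
        X k ∙ col (B ⊗ X) j + X k ∙ (λ i → c i * b j)
          ≡⟨ cong₂ _+_ (trans (sym (∙-assoc (X k) B (col X j))) (XAX k j)) (∙-* (X k) c (b j)) ⟩
        X k j + X k ∙ c * b j                        ≡⟨ cong (λ z → X k j + z * b j) (Xc k) ⟩
        X k j + 0ℚ * b j
          ≡⟨ solve 2 (λ p q → p :+ con 0ℚ :* q := p) refl (X k j) (b j) ⟩
        X k j                                        ∎

      Y-XAX : ∀ i j → (Y ⊗ A ⊗ Y) i j ≡ Y i j
      Y-XAX zero    j = trans (∙-assoc b A (col Y j)) (bAY j)
      Y-XAX (suc k) j = begin
        (Y ⊗ A ⊗ Y) (suc k) j                          ≡⟨ ∙-assoc (Y (suc k)) A (col Y j) ⟩
        Y (suc k) ∙ col (A ⊗ Y) j                      ≡⟨ row k (col (A ⊗ Y) j) ⟩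
        X k ∙ col (A ⊗ Y) j - d k * (b ∙ col (A ⊗ Y) j)
          ≡⟨ cong₂ (λ p q → p - d k * q) (XAY k j) (bAY j) ⟩
        X k j - d k * b j                              ∎

      result : ∃ (IsMoorePenrose A)
      result = Y , record
        { AXA = Y-AXA ; XAX = Y-XAX ; AXsym = Y-AXsym ; XAsym = Y-XAsym }

    split-bP : ∀ (b : Vector ℚ m) j → b ∙ (λ i → (B ⊗ X) i j + c i * b j)
                                    ≡ b ∙ col (B ⊗ X) j + b ∙ c * b j
    split-bP b j = trans (∙-+ b (col (B ⊗ X) j) (λ i → c i * b j))
                         (cong (b ∙ col (B ⊗ X) j +_) (∙-* b c (b j)))

    zero-case : (∀ i → c i ≡ 0ℚ) → ∃ (IsMoorePenrose A)
    zero-case c≡0 = Step.result b cb-sym bB cβ bP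
      where
      open +-*-Solver
      s = 1ℚ + d ∙ d
      instance _ = ≢-nonZero (1+u∙u≢0 d)
      κ = 1/ s

      b : Vector ℚ m
      b j = κ * (d ∙ col X j)

      1-β : 1ℚ - b ∙ a ≡ κ
      1-β = begin
        1ℚ - b ∙ a                            ≡⟨ cong (λ z → 1ℚ - z) (*-∙ κ (λ j → d ∙ col X j) a) ⟩
        1ℚ - κ * ((λ j → d ∙ col X j) ∙ a)    ≡⟨ cong (λ z → 1ℚ - κ * z) (∙-assoc d X a) ⟩
        1ℚ - κ * (d ∙ d)                      ≡⟨ cong (_- κ * (d ∙ d)) (sym (ℚ.*-inverseˡ s)) ⟩
        κ * s - κ * (d ∙ d)
          ≡⟨ solve 2 (λ k e → k :* (con 1ℚ :+ e) :- k :* e := k) refl κ (d ∙ d) ⟩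
        κ                                     ∎

      bB : ∀ j → b ∙ col B j ≡ d j * (1ℚ - b ∙ a)
      bB j = begin
        b ∙ col B j                              ≡⟨ *-∙ κ (λ j → d ∙ col X j) (col B j) ⟩
        κ * ((λ j → d ∙ col X j) ∙ col B j)      ≡⟨ cong (κ *_) (∙-assoc d X (col B j)) ⟩
        κ * (d ∙ col (X ⊗ B) j)                  ≡⟨ cong (κ *_) (dXB j) ⟩
        κ * d j                                  ≡⟨ ℚ.*-comm κ (d j) ⟩
        d j * κ                                  ≡⟨ cong (d j *_) (sym 1-β) ⟩
        d j * (1ℚ - b ∙ a)                       ∎

      cb-sym : ∀ i j → c i * b j ≡ c j * b i
      cb-sym i j = trans (trans (cong (_* b j) (c≡0 i)) (ℚ.*-zeroˡ (b j)))
                         (sym (trans (cong (_* b i) (c≡0 j)) (ℚ.*-zeroˡ (b i))))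

      cβ : ∀ i → c i * (b ∙ a) ≡ c i
      cβ i = trans (cong (_* (b ∙ a)) (c≡0 i))
                   (trans (ℚ.*-zeroˡ (b ∙ a)) (sym (c≡0 i)))

      bBX : ∀ j → b ∙ col (B ⊗ X) j ≡ b j
      bBX j = begin
        b ∙ col (B ⊗ X) j                        ≡⟨ ∙-assoc b B (col X j) ⟨
        (λ k → b ∙ col B k) ∙ col X j
          ≡⟨ ∙-congˡ (col X j) (λ k → trans (bB k) (trans (cong (d k *_) 1-β) (ℚ.*-comm (d k) κ))) ⟩
        (λ k → κ * d k) ∙ col X j                ≡⟨ *-∙ κ d (col X j) ⟩
        b j                                      ∎

      bP : ∀ j → b ∙ (λ i → (B ⊗ X) i j + c i * b j) ≡ b j
      bP j = trans (∙-congʳ b λ i →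
               trans (cong (λ z → (B ⊗ X) i j + z * b j) (c≡0 i))
                     (solve 2 (λ p q → p :+ con 0ℚ :* q := p) refl ((B ⊗ X) i j) (b j)))
               (bBX j)

    nonzero-case : c ∙ c ≢ 0ℚ → ∃ (IsMoorePenrose A)
    nonzero-case cc≢0 = Step.result b cb-sym bB cβ bP
      where
      open +-*-Solver
      instance _ = ≢-nonZero cc≢0
      κ = 1/ (c ∙ c)

      b : Vector ℚ m
      b j = κ * c j

      bc : b ∙ c ≡ 1ℚ
      bc = trans (*-∙ κ c c) (ℚ.*-inverseˡ (c ∙ c))

      bB0 : ∀ j → b ∙ col B j ≡ 0ℚ
      bB0 j = trans (*-∙ κ c (col B j)) (trans (cong (κ *_) (cB j)) (ℚ.*-zeroʳ κ))

      0-∙ : ∀ {p} (u v : Vector ℚ p) → (∀ k → u k ≡ 0ℚ) → u ∙ v ≡ 0ℚ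
      0-∙ u v u≡0 = begin
        u ∙ v                   ≡⟨ ∙-congˡ v (λ k → trans (u≡0 k) (sym (ℚ.*-zeroˡ (u k)))) ⟩
        (λ k → 0ℚ * u k) ∙ v    ≡⟨ *-∙ 0ℚ u v ⟩
        0ℚ * (u ∙ v)            ≡⟨ ℚ.*-zeroˡ (u ∙ v) ⟩
        0ℚ                      ∎

      β≡1 : b ∙ a ≡ 1ℚ
      β≡1 = begin
        b ∙ a                ≡⟨ solve 2 (λ p q → p := p :- q :+ q) refl (b ∙ a) (b ∙ Bd) ⟩
        b ∙ a - b ∙ Bd + b ∙ Bd  ≡⟨ cong₂ _+_ (sym (∙-- b a Bd)) (sym (∙-assoc b B d)) ⟩
        b ∙ c + (λ k → b ∙ col B k) ∙ d  ≡⟨ cong₂ _+_ bc (0-∙ _ d bB0) ⟩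
        1ℚ + 0ℚ              ≡⟨⟩
        1ℚ                   ∎

      bB : ∀ j → b ∙ col B j ≡ d j * (1ℚ - b ∙ a)
      bB j = begin
        b ∙ col B j          ≡⟨ bB0 j ⟩
        0ℚ                   ≡⟨ ℚ.*-zeroʳ (d j) ⟨
        d j * (1ℚ - 1ℚ)      ≡⟨ cong (λ z → d j * (1ℚ - z)) (sym β≡1) ⟩
        d j * (1ℚ - b ∙ a)   ∎

      cb-sym : ∀ i j → c i * b j ≡ c j * b i
      cb-sym i j = solve 3 (λ p q k → p :* (k :* q) := q :* (k :* p)) refl (c i) (c j) κ

      cβ : ∀ i → c i * (b ∙ a) ≡ c i
      cβ i = trans (cong (c i *_) β≡1) (ℚ.*-identityʳ (c i))

      bP : ∀ j → b ∙ (λ i → (B ⊗ X) i j + c i * b j) ≡ b j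
      bP j = begin
        b ∙ (λ i → (B ⊗ X) i j + c i * b j)   ≡⟨ split-bP b j ⟩
        b ∙ col (B ⊗ X) j + b ∙ c * b j
          ≡⟨ cong₂ (λ p q → p + q * b j)
               (trans (sym (∙-assoc b B (col X j))) (0-∙ _ (col X j) bB0)) bc ⟩
        0ℚ + 1ℚ * b j
          ≡⟨ solve 1 (λ p → con 0ℚ :+ con 1ℚ :* p := p) refl (b j) ⟩
        b j                                   ∎

    extend : ∃ (IsMoorePenrose A)
    extend with c ∙ c ℚ.≟ 0ℚ
    ... | yes cc≡0 = zero-case (u∙u≡0⇒u≡0 c cc≡0)
    ... | no  cc≢0 = nonzero-case cc≢0

opaque
  moorePenrose : ∀ {m n} (A : Matrix m n) → ∃ (IsMoorePenrose A)
  moorePenrose {m} {zero}  A = (λ ()) , record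
    { AXA = λ _ () ; XAX = λ () ; AXsym = λ _ _ → refl ; XAsym = λ () }
  moorePenrose {m} {suc n} A =
    let X , mp = moorePenrose (λ i j → A i (suc j)) in Greville.extend A X mp

infix 10 _†

_† : ∀ {m n} → Matrix m n → Matrix n m
A † = proj₁ (moorePenrose A)

†-isMoorePenrose : ∀ {m n} (A : Matrix m n) → IsMoorePenrose A (A †)
†-isMoorePenrose A = proj₂ (moorePenrose A)

------------------------------------------------------------------------
-- Resistance distance and Kirchhoff index

e : ∀ {m} → Fin m → Vector ℚ m
e i k = if does (i ≟ k) then 1ℚ else 0ℚ

module _ {m} (G : Graph m) where
  open Graph G using (adj?)

  adjacency : Matrix m m
  adjacency i j = if does (adj? i j) then 1ℚ else 0ℚ

  degree : Vector ℚ m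
  degree i = ∑[ j < m ] adjacency i j

  laplacian : Matrix m m
  laplacian i j = (if does (i ≟ j) then degree i else 0ℚ) - adjacency i j

  resistance : Fin m → Fin m → ℚ
  resistance i j = ∑[ k < m ] ∑[ l < m ] ((e i k - e j k) * (laplacian †) k l * (e i l - e j l))

  kirchhoff : ℚ
  kirchhoff = ½ * (∑[ i < m ] ∑[ j < m ] resistance i j)

------------------------------------------------------------------------
-- Generalized flower graphs

next : ∀ {n} → Fin n → Fin n
next {suc n} i = suc (toℕ i) ℕ.mod suc n

-- Every class of the vertex identification has exactly one
-- representative (i , a) with a ≢ y, because y in petal i is glued to x
-- in petal next i.  So the vertices of the flower are pairs of a petal
-- and an element of Fin m with y punched out; glue is the quotient map
-- (see glue-joint, glue-surjective and glue-fibre).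

glue : ∀ {m n} {x y : Fin m} → x ≢ y → Fin n → Fin m → Fin (n ℕ.* pred m)
glue {suc m} {n} {x} {y} x≢y i a with y ≟ a
... | yes _   = combine (next i) (punchOut {i = y} {j = x} (≢-sym x≢y))
... | no  y≢a = combine i (punchOut y≢a)

private
  next-cases : ∀ {n} (i : Fin (suc n)) →
    toℕ (next i) ≡ suc (toℕ i) ⊎ (toℕ (next i) ≡ 0 × toℕ i ≡ n)
  next-cases {n} i with ℕ.m≤n⇒m<n∨m≡n (toℕ<n i)
  ... | inj₁ 1+i<n = inj₁ (trans (toℕ-fromℕ< _) (ℕ.m<n⇒m%n≡m 1+i<n))
  ... | inj₂ 1+i≡n = inj₂
    ( trans (toℕ-fromℕ< _) (trans (cong (ℕ._% suc n) 1+i≡n) (ℕ.n%n≡0 (suc n)))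
    , ℕ.suc-injective 1+i≡n )

  next≢ : ∀ {n} → 2 ℕ.≤ n → (i : Fin n) → next i ≢ i
  next≢ {suc zero} (s≤s ()) i eq
  next≢ {suc (suc n)} _ i eq with next-cases i
  ... | inj₁ p       = ℕ.1+n≢n (trans (sym p) (cong toℕ eq))
  ... | inj₂ (p , q) = ℕ.0≢1+n (trans (sym p) (trans (cong toℕ eq) q))

  next-injective : ∀ {n} (i j : Fin n) → next i ≡ next j → i ≡ j
  next-injective {suc n} i j eq with next-cases i | next-cases j
  ... | inj₁ p       | inj₁ q       =
    toℕ-injective (ℕ.suc-injective (trans (sym p) (trans (cong toℕ eq) q)))
  ... | inj₁ p       | inj₂ (q , _) =
    contradiction (trans (sym q) (trans (cong toℕ (sym eq)) p)) ℕ.0≢1+n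
  ... | inj₂ (p , _) | inj₁ q       =
    contradiction (trans (sym p) (trans (cong toℕ eq) q)) ℕ.0≢1+n
  ... | inj₂ (_ , p) | inj₂ (_ , q) = toℕ-injective (trans p (sym q))

module _ {m} {x y : Fin m} (x≢y : x ≢ y) where

  glue-joint : ∀ {n} (i : Fin n) → glue x≢y i y ≡ glue x≢y (next i) x
  glue-joint i = go m x y x≢y i
    where
    go : ∀ m (x y : Fin m) (x≢y : x ≢ y) {n} (i : Fin n) →
         glue x≢y i y ≡ glue x≢y (next i) x
    go (suc m) x y x≢y i with y ≟ y | y ≟ x
    ... | no  y≢y | _       = contradiction refl y≢y
    ... | yes _   | yes y≡x = contradiction (sym y≡x) x≢y
    ... | yes _   | no  _   = cong (combine (next i)) (punchOut-cong y refl)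

  glue-surjective : ∀ {n} (u : Fin (n ℕ.* pred m)) → ∃ λ (i : Fin n) → ∃ λ a → glue x≢y i a ≡ u
  glue-surjective {n} u = go m x y x≢y {n} u
    where
    go : ∀ m (x y : Fin m) (x≢y : x ≢ y) {n} (u : Fin (n ℕ.* pred m)) →
         ∃ λ (i : Fin n) → ∃ λ a → glue x≢y i a ≡ u
    go (suc m) x y x≢y {n} u with i , k , refl ← combine-surjective {n} {m} u
      = i , punchIn y k , lem
      where
      lem : glue x≢y i (punchIn y k) ≡ combine i k
      lem with y ≟ punchIn y k
      ... | yes y≡ = contradiction (sym y≡) (punchInᵢ≢i y k)
      ... | no  _  = cong (combine i) (trans (punchOut-cong y refl) (punchOut-punchIn y))

  glue-fibre : ∀ {n} (i j : Fin n) a b → glue x≢y i a ≡ glue x≢y j b →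
    (i ≡ j × a ≡ b) ⊎ (a ≡ y × j ≡ next i × b ≡ x) ⊎ (b ≡ y × i ≡ next j × a ≡ x)
  glue-fibre i j a b eq = go m x y x≢y i j a b eq
    where
    go : ∀ m (x y : Fin m) (x≢y : x ≢ y) {n} (i j : Fin n) a b →
         glue x≢y i a ≡ glue x≢y j b →
         (i ≡ j × a ≡ b) ⊎ (a ≡ y × j ≡ next i × b ≡ x) ⊎ (b ≡ y × i ≡ next j × a ≡ x)
    go (suc m) x y x≢y i j a b eq with y ≟ a | y ≟ b
    ... | yes y≡a | yes y≡b = inj₁
      (next-injective i j (proj₁ (combine-injective (next i) _ (next j) _ eq)) , trans (sym y≡a) y≡b)
    ... | yes y≡a | no  y≢b with p , q ← combine-injective (next i) _ j _ eq
      = inj₂ (inj₁ (sym y≡a , sym p , sym (punchOut-injective (≢-sym x≢y) y≢b q)))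
    ... | no  y≢a | yes y≡b with p , q ← combine-injective i _ (next j) _ eq
      = inj₂ (inj₂ (sym y≡b , p , punchOut-injective y≢a (≢-sym x≢y) q))
    ... | no  y≢a | no  y≢b with p , q ← combine-injective i _ j _ eq
      = inj₁ (p , punchOut-injective y≢a y≢b q)

  glue-injective : ∀ {n} → 2 ℕ.≤ n → (i : Fin n) → ∀ {a b} →
                   glue x≢y i a ≡ glue x≢y i b → a ≡ b
  glue-injective 2≤n i {a} {b} eq with glue-fibre i i a b eq
  ... | inj₁ (_ , a≡b)                         = a≡b
  ... | inj₂ (inj₁ (_ , i≡ , _))               = contradiction (sym i≡) (next≢ 2≤n i)
  ... | inj₂ (inj₂ (_ , i≡ , _))        = contradiction (sym i≡) (next≢ 2≤n i)

-- For n ≥ 3 no two petals share an edge, even when x and y are adjacent,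
-- so the image of the petals under glue is again a simple graph with no
-- edges merged.

flower : ∀ {m} n → 3 ℕ.≤ n → (G : Graph m) (x y : Fin m) → x ≢ y → Graph (n ℕ.* pred m)
flower n 3≤n G x y x≢y = record
  { Adj        = λ u v → ∃ λ i → ∃ λ a → ∃ λ b →
                   glue x≢y i a ≡ u × glue x≢y i b ≡ v × Adj a b
  ; adj?       = λ u v → any? λ (i : Fin n) → any? λ a → any? λ b →
                   (glue x≢y i a ≟ u) ×-dec ((glue x≢y i b ≟ v) ×-dec adj? a b)
  ; adj-sym    = λ (i , a , b , p , q , ab) → i , b , a , q , p , adj-sym ab
  ; adj-irrefl = λ { u≡v (i , a , b , p , q , ab) →
                   adj-irrefl (glue-injective x≢y (ℕ.≤-trans (ℕ.n≤1+n 2) 3≤n) i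
                                (trans p (trans u≡v (sym q)))) ab }
  }
  where open Graph G

{-# OPTIONS --safe #-}
module Submission where

-- A potential with source s and sink t (a solution of L f = e s − e t) computes the resistance as
-- f s − f t, and on a connected graph the maximum principle for L provides existence of potentials, the
-- bounds f t ≤ f ≤ f s and the triangle inequality for the resistance.
--
-- For a, b in one petal, let g and h be the potentials on G for (a , b) and (x , y), let r be the
-- resistance of x and y, and let t = g x − g y.  The potential on the flower is α h on every petal plus g
-- on the chosen one, with α = − t / (n r), so the resistance drops by exactly t² / (n r).  Since
-- t = h a − h b, we have |t| ≤ r, and the drop lies between 0 and r / n.  Summing over the pairs inside a
-- petal gives the lower bound.
--
-- For the upper bound, route a in petal i to b in petal j via x in i and x in j; the two copies of x are at
-- most d r apart, where d is the number of steps forward from i to j, and d i j + d j i = n for i ≢ j.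

open import Defs
open import Data.Nat.Base as ℕ using (ℕ; zero; suc; pred; s≤s; z≤n)
open import Data.Fin.Base using (Fin; zero; suc; toℕ; inject₁)
open import Data.Integer.Base as ℤ using ()
open import Data.Rational.Base using (ℚ; 0ℚ; 1ℚ; ½; _+_; _*_; _-_; -_; 1/_; _/_; _≤_; nonNegative; toℚᵘ; ≢-nonZero)
open import Data.Product.Base using (∃; _×_; _,_; proj₁; proj₂)
open import Relation.Binary.PropositionalEquality hiding ([_]; J)

open import Algebra.Bundles using (CommutativeRing)
open import Data.Bool.Base using (if_then_else_)
import Data.Fin.Base as Fin
open import Data.Fin.Properties using (_≟_; toℕ<n; toℕ-injective; toℕ-fromℕ<; toℕ-fromℕ; toℕ-inject₁)
import Data.Integer.Properties as ℤ
import Data.Nat.DivMod as ℕ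
import Data.Nat.Properties as ℕ
import Data.Rational.Properties as ℚ
open import Data.Rational.Solver using (module +-*-Solver)
open import Data.Rational.Unnormalised.Base as ℚᵘ using (mkℚᵘ)
import Data.Rational.Unnormalised.Properties as ℚᵘ
open import Data.Sum.Base using (_⊎_; inj₁; inj₂)
open import Data.Vec.Functional using (Vector)
open import Function.Base using (_∘_)
open import Function.Bundles using (mk⇔)
open import Relation.Binary.Construct.Closure.ReflexiveTransitive using (Star; ε; _◅_; _◅◅_; gmap)
open import Relation.Nullary.Decidable using (Dec; does; yes; no; does-⇔; dec-true; dec-false; _×-dec_; ¬?)
open import Relation.Nullary.Negation using (¬_; contradiction)

open import Algebra.Properties.Semiring.Sum (CommutativeRing.semiring ℚ.+-*-commutativeRing)
  using (sum; sum-syntax; sum-cong-≗; ∑-distrib-+; ∑-comm; *-distribˡ-sum; *-distribʳ-sum; sum-init-last)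

open +-*-Solver using (solve; _:=_; _:+_; _:*_; _:-_; :-_; con)

-- Ordered-field arithmetic in ℚ

p-q≤0⇒p≤q : ∀ {p q} → p - q ≤ 0ℚ → p ≤ q
p-q≤0⇒p≤q {p} {q} h = subst₂ _≤_
  (solve 2 (λ a b → a :- b :+ b := a) refl p q) (ℚ.+-identityˡ q) (ℚ.+-monoˡ-≤ q h)

0≤q-p⇒p≤q : ∀ {p q} → 0ℚ ≤ q - p → p ≤ q
0≤q-p⇒p≤q {p} {q} h = subst₂ _≤_
  (ℚ.+-identityˡ p) (solve 2 (λ a b → b :- a :+ a := b) refl p q) (ℚ.+-monoˡ-≤ p h)

p≤q⇒0≤q-p : ∀ {p q} → p ≤ q → 0ℚ ≤ q - p
p≤q⇒0≤q-p {p} {q} h = subst (_≤ q - p) (ℚ.+-inverseʳ p) (ℚ.+-monoˡ-≤ (- p) h)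

*-monoˡ : ∀ {p q r} → 0ℚ ≤ r → p ≤ q → r * p ≤ r * q
*-monoˡ {r = r} 0≤r = ℚ.*-monoˡ-≤-nonNeg r {{nonNegative 0≤r}}

0≤* : ∀ {p q} → 0ℚ ≤ p → 0ℚ ≤ q → 0ℚ ≤ p * q
0≤* {p} {q} 0≤p 0≤q = subst (_≤ p * q) (ℚ.*-zeroʳ p) (*-monoˡ 0≤p 0≤q)

0≤1 : 0ℚ ≤ 1ℚ
0≤1 = ℚ.nonNegative⁻¹ 1ℚ

0≤p² : ∀ p → 0ℚ ≤ p * p
0≤p² p with ℚ.≤-total 0ℚ p
... | inj₁ 0≤p = 0≤* 0≤p 0≤p
... | inj₂ p≤0 = subst (0ℚ ≤_) (solve 1 (λ a → (:- a) :* (:- a) := a :* a) refl p)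
                   (0≤* (ℚ.neg-antimono-≤ p≤0) (ℚ.neg-antimono-≤ p≤0))

-- Here `s` is the quotient t / r, so that `s * t` is t² / r. When r = 0 the two bounds force t = 0,
-- and `s` is taken to be 0.
ratio : ∀ {r t} → - r ≤ t → t ≤ r → ∃ λ s → s * r ≡ t × 0ℚ ≤ s * t × s * t ≤ r
ratio {r} {t} -r≤t t≤r with r ℚ.≟ 0ℚ
... | yes refl = 0ℚ , ℚ.≤-antisym -r≤t t≤r , ℚ.≤-reflexive (sym (ℚ.*-zeroˡ t)) , ℚ.≤-reflexive (ℚ.*-zeroˡ t)
... | no r≢0 = t * 1/ r
  , trans (ℚ.*-assoc t (1/ r) r) (trans (cong (t *_) (ℚ.*-inverseˡ r)) (ℚ.*-identityʳ t))
  , subst (0ℚ ≤_) (solve 2 (λ a b → b :* (a :* a) := a :* b :* a) refl t (1/ r)) (0≤* 0≤1/r (0≤p² t))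
  -- r - t² / r = (1 / r)(r - t)(r + t), a product of nonnegative factors.
  , 0≤q-p⇒p≤q (subst (0ℚ ≤_)
      (trans (solve 3 (λ a b c → c :* ((b :- a) :* (a :- :- b)) := b :* (c :* b) :- a :* c :* a) refl t r (1/ r))
             (cong (_- t * 1/ r * t) (trans (cong (r *_) (ℚ.*-inverseˡ r)) (ℚ.*-identityʳ r))))
      (0≤* 0≤1/r (0≤* (p≤q⇒0≤q-p t≤r) (p≤q⇒0≤q-p -r≤t))))
  where
  0≤r : 0ℚ ≤ r
  0≤r with ℚ.≤-total 0ℚ r
  ... | inj₁ h = h
  ... | inj₂ h = ℚ.≤-trans (ℚ.neg-antimono-≤ h) (ℚ.≤-trans -r≤t t≤r)
  instance
    r-pos = ℚ.nonNeg∧nonZero⇒pos r {{nonNegative 0≤r}} {{≢-nonZero r≢0}}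
    r≢0ℚ  = ℚ.pos⇒nonZero r
  0≤1/r : 0ℚ ≤ 1/ r
  0≤1/r = ℚ.nonNegative⁻¹ (1/ r) {{ℚ.pos⇒nonNeg (1/ r) {{ℚ.1/pos⇒pos r}}}}

-- Normalisation of fractions blocks computation on a variable `n`; for unnormalised rationals the
-- equation is a cross-multiplication of integers.
fromℕ-suc : ∀ n → fromℕ (suc n) ≡ 1ℚ + fromℕ n
fromℕ-suc n = ℚ.toℚᵘ-injective (begin
  toℚᵘ (fromℕ (suc n))            ≈⟨ ℚ.toℚᵘ-fromℚᵘ (mkℚᵘ (ℤ.+ suc n) 0) ⟩
  mkℚᵘ (ℤ.+ suc n) 0              ≈⟨ ℚᵘ.*≡* (cong (ℤ._* ℤ.1ℤ) (cong (ℤ._+_ (ℤ.+ 1)) (sym (ℤ.*-identityʳ (ℤ.+ n))))) ⟩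
  toℚᵘ 1ℚ ℚᵘ.+ mkℚᵘ (ℤ.+ n) 0     ≈⟨ ℚᵘ.+-congʳ (toℚᵘ 1ℚ) (ℚᵘ.≃-sym (ℚ.toℚᵘ-fromℚᵘ (mkℚᵘ (ℤ.+ n) 0))) ⟩
  toℚᵘ 1ℚ ℚᵘ.+ toℚᵘ (fromℕ n)     ≈⟨ ℚᵘ.≃-sym (ℚ.toℚᵘ-homo-+ 1ℚ (fromℕ n)) ⟩
  toℚᵘ (1ℚ + fromℕ n)             ∎)
  where open ℚᵘ.≃-Reasoning

fromℕ-+ : ∀ m n → fromℕ (m ℕ.+ n) ≡ fromℕ m + fromℕ n
fromℕ-+ zero    n = sym (ℚ.+-identityˡ (fromℕ n))
fromℕ-+ (suc m) n = begin
  fromℕ (suc (m ℕ.+ n))       ≡⟨ fromℕ-suc (m ℕ.+ n) ⟩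
  1ℚ + fromℕ (m ℕ.+ n)        ≡⟨ cong (1ℚ +_) (fromℕ-+ m n) ⟩
  1ℚ + (fromℕ m + fromℕ n)    ≡⟨ ℚ.+-assoc 1ℚ (fromℕ m) (fromℕ n) ⟨
  1ℚ + fromℕ m + fromℕ n      ≡⟨ cong (_+ fromℕ n) (fromℕ-suc m) ⟨
  fromℕ (suc m) + fromℕ n     ∎
  where open ≡-Reasoning

0≤fromℕ : ∀ n → 0ℚ ≤ fromℕ n
0≤fromℕ zero    = ℚ.≤-refl
0≤fromℕ (suc n) = subst (0ℚ ≤_) (sym (fromℕ-suc n)) (ℚ.+-mono-≤ 0≤1 (0≤fromℕ n))

fromℕ-inverse : ∀ n .{{_ : ℕ.NonZero n}} → ∃ λ ν → 0ℚ ≤ ν × fromℕ n * ν ≡ 1ℚ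
fromℕ-inverse (suc n) =
  1/ N , ℚ.nonNegative⁻¹ (1/ N) {{ℚ.pos⇒nonNeg (1/ N) {{ℚ.1/pos⇒pos N}}}} , ℚ.*-inverseʳ N
  where
  N = fromℕ (suc n)
  instance
    N-pos = ℚ.normalize-pos (suc n) 1
    N≢0   = ℚ.pos⇒nonZero N

-- Finite sums and indicators

sum-mono : ∀ {n} {f g : Vector ℚ n} → (∀ k → f k ≤ g k) → sum f ≤ sum g
sum-mono {zero}  f≤g = ℚ.≤-refl
sum-mono {suc n} f≤g = ℚ.+-mono-≤ (f≤g zero) (sum-mono (f≤g ∘ suc))

sum-const : ∀ n c → ∑[ k < n ] c ≡ fromℕ n * c
sum-const zero    c = sym (ℚ.*-zeroˡ c)
sum-const (suc n) c = trans (cong (c +_) (sum-const n c))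
  (trans (solve 2 (λ a b → a :+ b :* a := (con 1ℚ :+ b) :* a) refl c (fromℕ n))
         (cong (_* c) (sym (fromℕ-suc n))))

sum-zero : ∀ {n} {f : Vector ℚ n} → (∀ k → f k ≡ 0ℚ) → sum f ≡ 0ℚ
sum-zero {n} f≡0 = trans (sum-cong-≗ f≡0) (trans (sum-const n 0ℚ) (ℚ.*-zeroʳ (fromℕ n)))

sum-- : ∀ {n} (f g : Vector ℚ n) → ∑[ k < n ] (f k - g k) ≡ sum f - sum g
sum-- {n} f g = begin
  ∑[ k < n ] (f k - g k)             ≡⟨ sum-cong-≗ (λ k → neg (f k) (g k)) ⟩
  ∑[ k < n ] (f k + - 1ℚ * g k)      ≡⟨ ∑-distrib-+ f (λ k → - 1ℚ * g k) ⟩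
  sum f + ∑[ k < n ] (- 1ℚ * g k)    ≡⟨ cong (sum f +_) (*-distribˡ-sum (- 1ℚ) g) ⟨
  sum f + - 1ℚ * sum g               ≡⟨ neg (sum f) (sum g) ⟨
  sum f - sum g                      ∎
  where
  open ≡-Reasoning
  neg : ∀ p q → p - q ≡ p + - 1ℚ * q
  neg = solve 2 (λ p q → p :- q := p :+ (:- con 1ℚ) :* q) refl

sum-nonneg : ∀ {n} {f : Vector ℚ n} → (∀ k → 0ℚ ≤ f k) → 0ℚ ≤ sum f
sum-nonneg {n} {f} 0≤f = subst (_≤ sum f) (sum-zero {n} (λ _ → refl)) (sum-mono 0≤f)

sum-e : ∀ {n} (i : Fin n) (f : Vector ℚ n) → ∑[ k < n ] (e i k * f k) ≡ f i
sum-e {suc n} zero f = trans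
  (cong₂ _+_ (ℚ.*-identityˡ (f zero)) (sum-zero {n} (λ k → ℚ.*-zeroˡ (f (suc k)))))
  (ℚ.+-identityʳ (f zero))
sum-e {suc n} (suc i) f = trans
  (cong₂ _+_ (ℚ.*-zeroˡ (f zero)) (sum-e i (f ∘ suc)))
  (ℚ.+-identityˡ (f (suc i)))

-- Entries of `e` and of `adjacency` are definitionally of this form, so the lemmas on indicators
-- apply to them directly.
𝟙 : ∀ {a} {A : Set a} → Dec A → ℚ
𝟙 d = if does d then 1ℚ else 0ℚ

𝟙-cong : ∀ {a b} {A : Set a} {B : Set b} (d : Dec A) (d′ : Dec B) → (A → B) → (B → A) → 𝟙 d ≡ 𝟙 d′
𝟙-cong d d′ f g = cong (if_then 1ℚ else 0ℚ) (does-⇔ (mk⇔ f g) d d′)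

𝟙-true : ∀ {a} {A : Set a} (d : Dec A) → A → 𝟙 d ≡ 1ℚ
𝟙-true d p = cong (if_then 1ℚ else 0ℚ) (dec-true d p)

𝟙-false : ∀ {a} {A : Set a} (d : Dec A) → ¬ A → 𝟙 d ≡ 0ℚ
𝟙-false d ¬p = cong (if_then 1ℚ else 0ℚ) (dec-false d ¬p)

0≤𝟙 : ∀ {a} {A : Set a} (d : Dec A) → 0ℚ ≤ 𝟙 d
0≤𝟙 (yes _) = 0≤1
0≤𝟙 (no _)  = ℚ.≤-refl

𝟙≤1 : ∀ {a} {A : Set a} (d : Dec A) → 𝟙 d ≤ 1ℚ
𝟙≤1 (yes _) = ℚ.≤-refl
𝟙≤1 (no _)  = 0≤1

𝟙-× : ∀ {a b} {A : Set a} {B : Set b} (d : Dec A) (d′ : Dec B) → 𝟙 (d ×-dec d′) ≡ 𝟙 d * 𝟙 d′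
𝟙-× (yes _) (yes _) = refl
𝟙-× (yes _) (no _)  = refl
𝟙-× (no _)  (yes _) = refl
𝟙-× (no _)  (no _)  = refl

e-sym : ∀ {m} (i j : Fin m) → e i j ≡ e j i
e-sym i j = 𝟙-cong (i ≟ j) (j ≟ i) sym sym

e-subst : ∀ {m} (i k : Fin m) (f : Vector ℚ m) → e i k * f k ≡ e i k * f i
e-subst i k f with i ≟ k
... | yes refl = refl
... | no  _    = trans (ℚ.*-zeroˡ (f k)) (sym (ℚ.*-zeroˡ (f i)))

sum-e-const : ∀ {n} (i : Fin n) → ∑[ k < n ] (e i k) ≡ 1ℚ
sum-e-const i = trans (sum-cong-≗ (λ k → sym (ℚ.*-identityʳ (e i k)))) (sum-e i (λ _ → 1ℚ))

sum-1-e : ∀ {m} (i : Fin m) → ∑[ j < m ] (1ℚ - e i j) ≡ fromℕ m - 1ℚ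
sum-1-e {m} i = trans (sum-- (λ _ → 1ℚ) (e i))
  (cong₂ _-_ (trans (sum-const m 1ℚ) (ℚ.*-identityʳ (fromℕ m))) (sum-e-const i))

-- A single term is the sum of `f` weighted by `e i`, and every weight is at most 1.
term≤sum : ∀ {n} {f : Vector ℚ n} → (∀ k → 0ℚ ≤ f k) → ∀ i → f i ≤ sum f
term≤sum {f = f} 0≤f i = subst (_≤ sum f) (sum-e i f) (sum-mono λ k →
  subst (e i k * f k ≤_) (ℚ.*-identityˡ (f k))
    (ℚ.*-monoʳ-≤-nonNeg (f k) {{nonNegative (0≤f k)}} (𝟙≤1 (i ≟ k))))

-- The argument of type `Fin n` guarantees that the index set is inhabited.
argmax : ∀ {n} → Fin n → (f : Vector ℚ n) → ∃ λ k → ∀ l → f l ≤ f k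
argmax {suc zero}    _ f = zero , λ { zero → ℚ.≤-refl }
argmax {suc (suc n)} _ f with k , max ← argmax zero (f ∘ suc) with ℚ.≤-total (f zero) (f (suc k))
... | inj₁ h = suc k , λ { zero → h ; (suc l) → max l }
... | inj₂ h = zero  , λ { zero → ℚ.≤-refl ; (suc l) → ℚ.≤-trans (max l) h }

-- Matrices acting on vectors, and the standard bilinear form

infixr 8 _▹_

_▹_ : ∀ {m n} → Matrix m n → Vector ℚ n → Vector ℚ m
_▹_ {n = n} A f i = ∑[ k < n ] (A i k * f k)

⟨_,_⟩ : ∀ {n} → Vector ℚ n → Vector ℚ n → ℚ
⟨_,_⟩ {n} f g = ∑[ k < n ] (f k * g k)

▹-cong : ∀ {m n} (A : Matrix m n) {f g : Vector ℚ n} → (∀ k → f k ≡ g k) → ∀ i → (A ▹ f) i ≡ (A ▹ g) i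
▹-cong A f≡g i = sum-cong-≗ λ k → cong (A i k *_) (f≡g k)

▹-+ : ∀ {m n} (A : Matrix m n) (f g : Vector ℚ n) i → (A ▹ (λ k → f k + g k)) i ≡ (A ▹ f) i + (A ▹ g) i
▹-+ A f g i = trans (sum-cong-≗ λ k → ℚ.*-distribˡ-+ (A i k) (f k) (g k))
                    (∑-distrib-+ (λ k → A i k * f k) (λ k → A i k * g k))

▹-* : ∀ {m n} (A : Matrix m n) c (f : Vector ℚ n) i → (A ▹ (λ k → c * f k)) i ≡ c * (A ▹ f) i
▹-* A c f i = trans
  (sum-cong-≗ λ k → solve 3 (λ a b d → a :* (b :* d) := b :* (a :* d)) refl (A i k) c (f k))
  (sym (*-distribˡ-sum c (λ k → A i k * f k)))

▹-⊗ : ∀ {m n p} (A : Matrix m n) (B : Matrix n p) (f : Vector ℚ p) i → ((A ⊗ B) ▹ f) i ≡ (A ▹ B ▹ f) i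
▹-⊗ {m} {n} {p} A B f i = begin
  ∑[ k < p ] ((A ⊗ B) i k * f k)
    ≡⟨ sum-cong-≗ (λ k → *-distribʳ-sum (f k) (λ l → A i l * B l k)) ⟩
  ∑[ k < p ] ∑[ l < n ] (A i l * B l k * f k)
    ≡⟨ ∑-comm (λ k l → A i l * B l k * f k) ⟩
  ∑[ l < n ] ∑[ k < p ] (A i l * B l k * f k)
    ≡⟨ sum-cong-≗ (λ l → trans (sum-cong-≗ λ k → ℚ.*-assoc (A i l) (B l k) (f k))
                               (sym (*-distribˡ-sum (A i l) (λ k → B l k * f k)))) ⟩
  ∑[ l < n ] (A i l * (B ▹ f) l) ∎
  where open ≡-Reasoning

⟨⟩-comm : ∀ {n} (f g : Vector ℚ n) → ⟨ f , g ⟩ ≡ ⟨ g , f ⟩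
⟨⟩-comm f g = sum-cong-≗ λ k → ℚ.*-comm (f k) (g k)

⟨⟩-congʳ : ∀ {n} (f : Vector ℚ n) {g h} → (∀ k → g k ≡ h k) → ⟨ f , g ⟩ ≡ ⟨ f , h ⟩
⟨⟩-congʳ f g≡h = sum-cong-≗ λ k → cong (f k *_) (g≡h k)

⟨⟩-congˡ : ∀ {n} {f h : Vector ℚ n} g → (∀ k → f k ≡ h k) → ⟨ f , g ⟩ ≡ ⟨ h , g ⟩
⟨⟩-congˡ g f≡h = sum-cong-≗ λ k → cong (_* g k) (f≡h k)

⟨⟩-adjoint : ∀ {n} (A : Matrix n n) → (∀ i j → A i j ≡ A j i) → ∀ f g → ⟨ A ▹ f , g ⟩ ≡ ⟨ f , A ▹ g ⟩
⟨⟩-adjoint {n} A A-sym f g = begin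
  ∑[ i < n ] ((A ▹ f) i * g i)
    ≡⟨ sum-cong-≗ (λ i → *-distribʳ-sum (g i) (λ k → A i k * f k)) ⟩
  ∑[ i < n ] ∑[ k < n ] (A i k * f k * g i)
    ≡⟨ ∑-comm (λ i k → A i k * f k * g i) ⟩
  ∑[ k < n ] ∑[ i < n ] (A i k * f k * g i)
    ≡⟨ sum-cong-≗ (λ k → trans
         (sum-cong-≗ λ i → trans (cong (λ z → z * f k * g i) (A-sym i k))
            (solve 3 (λ a b c → a :* b :* c := b :* (a :* c)) refl (A k i) (f k) (g i)))
         (sym (*-distribˡ-sum (f k) (λ i → A k i * g i)))) ⟩
  ∑[ k < n ] (f k * (A ▹ g) k) ∎
  where open ≡-Reasoning

-- A unit current entering at `s` and leaving at `t`.
δ : ∀ {m} → Fin m → Fin m → Vector ℚ m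
δ s t k = e s k - e t k

⟨δ⟩ : ∀ {m} (s t : Fin m) (f : Vector ℚ m) → ⟨ δ s t , f ⟩ ≡ f s - f t
⟨δ⟩ {m} s t f = begin
  ∑[ k < m ] ((e s k - e t k) * f k)
    ≡⟨ sum-cong-≗ (λ k → solve 3 (λ a b c → (a :- b) :* c := a :* c :- b :* c) refl (e s k) (e t k) (f k)) ⟩
  ∑[ k < m ] (e s k * f k - e t k * f k)
    ≡⟨ sum-- (λ k → e s k * f k) (λ k → e t k * f k) ⟩
  ∑[ k < m ] (e s k * f k) - ∑[ k < m ] (e t k * f k)
    ≡⟨ cong₂ _-_ (sum-e s f) (sum-e t f) ⟩
  f s - f t ∎
  where open ≡-Reasoning

-- Potentials and resistance

module Potential {m} (G : Graph m) where
  open Graph G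

  L : Matrix m m
  L = laplacian G

  A : Matrix m m
  A = adjacency G

  A-sym : ∀ i j → A i j ≡ A j i
  A-sym i j = 𝟙-cong (adj? i j) (adj? j i) adj-sym adj-sym

  -- With the conditional turned into a factor, the ring solver and `sum-e` can be applied.
  L-diag : ∀ i j → L i j ≡ e i j * degree G i - A i j
  L-diag i j with i ≟ j
  ... | yes _ = cong (_- A i j) (sym (ℚ.*-identityˡ (degree G i)))
  ... | no  _ = cong (_- A i j) (sym (ℚ.*-zeroˡ (degree G i)))

  L-sym : ∀ i j → L i j ≡ L j i
  L-sym i j = begin
    L i j                          ≡⟨ L-diag i j ⟩
    e i j * degree G i - A i j     ≡⟨ cong₂ _-_ (sym (e-subst i j (degree G))) (A-sym i j) ⟩
    e i j * degree G j - A j i     ≡⟨ cong (λ z → z * degree G j - A j i) (e-sym i j) ⟩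
    e j i * degree G j - A j i     ≡⟨ L-diag j i ⟨
    L j i                          ∎
    where open ≡-Reasoning

  -- The degree is a row sum of `A`, so the diagonal term spreads over the neighbours. The result is
  -- the net current out of `u` under unit conductances.
  L▹≡ : ∀ f u → (L ▹ f) u ≡ ∑[ v < m ] (A u v * (f u - f v))
  L▹≡ f u = begin
    ∑[ v < m ] (L u v * f v)
      ≡⟨ sum-cong-≗ (λ v → trans (cong (_* f v) (L-diag u v))
           (solve 4 (λ a b c d → (a :* b :- c) :* d := a :* (b :* d) :- c :* d) refl
             (e u v) (degree G u) (A u v) (f v))) ⟩
    ∑[ v < m ] (e u v * (degree G u * f v) - A u v * f v)
      ≡⟨ sum-- (λ v → e u v * (degree G u * f v)) (λ v → A u v * f v) ⟩
    ∑[ v < m ] (e u v * (degree G u * f v)) - ∑[ v < m ] (A u v * f v)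
      ≡⟨ cong (_- ∑[ v < m ] (A u v * f v))
           (trans (sum-e u (λ v → degree G u * f v)) (*-distribʳ-sum (f u) (A u))) ⟩
    ∑[ v < m ] (A u v * f u) - ∑[ v < m ] (A u v * f v)
      ≡⟨ sum-- (λ v → A u v * f u) (λ v → A u v * f v) ⟨
    ∑[ v < m ] (A u v * f u - A u v * f v)
      ≡⟨ sum-cong-≗ (λ v → solve 3 (λ a b c → a :* b :- a :* c := a :* (b :- c)) refl (A u v) (f u) (f v)) ⟩
    ∑[ v < m ] (A u v * (f u - f v)) ∎
    where open ≡-Reasoning

  -- Wrapping the equation in a record lets `s`, `t` and `f` be recovered by unification from the
  -- type of a proof.
  record IsPotential (s t : Fin m) (f : Vector ℚ m) : Set where
    constructor mkPotential
    field
      L▹≡δ : ∀ u → (L ▹ f) u ≡ δ s t u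

  open IsPotential public

  L▹const : ∀ c u → (L ▹ (λ _ → c)) u ≡ 0ℚ
  L▹const c u = trans (L▹≡ (λ _ → c) u)
    (sum-zero λ v → trans (cong (A u v *_) (ℚ.+-inverseʳ c)) (ℚ.*-zeroʳ (A u v)))

  resistance-mv : ∀ s t → resistance G s t ≡ ⟨ δ s t , L † ▹ δ s t ⟩
  resistance-mv s t = sum-cong-≗ λ k → trans
    (sum-cong-≗ λ l → ℚ.*-assoc (δ s t k) ((L †) k l) (δ s t l))
    (sym (*-distribˡ-sum (δ s t k) (λ l → (L †) k l * δ s t l)))

  -- Replace both copies of δ by `L ▹ f`, move one `L` across by symmetry and collapse L L† L to L:
  -- the energy ⟨L f , f⟩ remains, whatever solution `f` was chosen.
  resistance-potential : ∀ {s t f} → IsPotential s t f → resistance G s t ≡ f s - f t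
  resistance-potential {s} {t} {f} (mkPotential Lf) = begin
    resistance G s t                       ≡⟨ resistance-mv s t ⟩
    ⟨ δ s t , L † ▹ δ s t ⟩                ≡⟨ ⟨⟩-congˡ (L † ▹ δ s t) (sym ∘ Lf) ⟩
    ⟨ L ▹ f , L † ▹ δ s t ⟩                ≡⟨ ⟨⟩-congʳ (L ▹ f) (▹-cong (L †) (sym ∘ Lf)) ⟩
    ⟨ L ▹ f , L † ▹ L ▹ f ⟩                ≡⟨ ⟨⟩-adjoint L L-sym f (L † ▹ L ▹ f) ⟩
    ⟨ f , L ▹ L † ▹ L ▹ f ⟩                ≡⟨ ⟨⟩-congʳ f LL†L ⟩
    ⟨ f , L ▹ f ⟩                          ≡⟨ ⟨⟩-comm f (L ▹ f) ⟩
    ⟨ L ▹ f , f ⟩                          ≡⟨ ⟨⟩-congˡ f Lf ⟩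
    ⟨ δ s t , f ⟩                          ≡⟨ ⟨δ⟩ s t f ⟩
    f s - f t                              ∎
    where
    open ≡-Reasoning
    LL†L : ∀ k → (L ▹ L † ▹ L ▹ f) k ≡ (L ▹ f) k
    LL†L k = begin
      (L ▹ L † ▹ L ▹ f) k         ≡⟨ ▹-⊗ L (L †) (L ▹ f) k ⟨
      ((L ⊗ L †) ▹ L ▹ f) k       ≡⟨ ▹-⊗ (L ⊗ L †) L f k ⟨
      ((L ⊗ L † ⊗ L) ▹ f) k       ≡⟨ sum-cong-≗ (λ l → cong (_* f l) (IsMoorePenrose.AXA (†-isMoorePenrose L) k l)) ⟩
      (L ▹ f) k                   ∎

  -- Both sides evaluate ⟨L f , g⟩ = ⟨f , L g⟩.
  reciprocity : ∀ {s t a b f g} → IsPotential s t f → IsPotential a b g → g s - g t ≡ f a - f b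
  reciprocity {s} {t} {a} {b} {f} {g} (mkPotential Lf) (mkPotential Lg) = begin
    g s - g t         ≡⟨ ⟨δ⟩ s t g ⟨
    ⟨ δ s t , g ⟩     ≡⟨ ⟨⟩-congˡ g Lf ⟨
    ⟨ L ▹ f , g ⟩     ≡⟨ ⟨⟩-adjoint L L-sym f g ⟩
    ⟨ f , L ▹ g ⟩     ≡⟨ ⟨⟩-congʳ f Lg ⟩
    ⟨ f , δ a b ⟩     ≡⟨ ⟨⟩-comm f (δ a b) ⟩
    ⟨ δ a b , f ⟩     ≡⟨ ⟨δ⟩ a b f ⟩
    f a - f b         ∎
    where open ≡-Reasoning

  resistance-refl : ∀ s → resistance G s s ≡ 0ℚ
  resistance-refl s = trans (resistance-potential {s} {s} {λ _ → 0ℚ} (mkPotential λ u →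
    trans (L▹const 0ℚ u) (sym (ℚ.+-inverseʳ (e s u))))) refl

  -- The maximum principle and its consequences on a connected graph

  module _ (conn : Connected G) where

    Max : Vector ℚ m → Fin m → Set
    Max f u = ∀ w → f w ≤ f u

    -- At a maximum every summand of `L▹≡` is nonnegative. Their sum is at most 0, so each summand
    -- is at most 0, and the one of the neighbour `v` gives f u ≤ f v.
    max-step : ∀ {f u v} → Max f u → (L ▹ f) u ≤ 0ℚ → Adj u v → Max f v
    max-step {f} {u} {v} max Lf≤0 uv w = ℚ.≤-trans (max w) (p-q≤0⇒p≤q (subst (_≤ 0ℚ)
      (trans (cong (_* (f u - f v)) (𝟙-true (adj? u v) uv)) (ℚ.*-identityˡ (f u - f v)))
      (ℚ.≤-trans
        (term≤sum (λ v → 0≤* (0≤𝟙 (adj? u v)) (p≤q⇒0≤q-p (max v))) v)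
        (subst (_≤ 0ℚ) (L▹≡ f u) Lf≤0))))

    max-walk : ∀ {f s} → (∀ u → u ≢ s → (L ▹ f) u ≤ 0ℚ) → ∀ {u} → Star Adj u s → Max f u → Max f s
    max-walk sub ε max = max
    max-walk {s = s} sub {u} (uv ◅ vs) max with u ≟ s
    ... | yes refl = max
    ... | no  u≢s  = max-walk sub vs (max-step max (sub u u≢s) uv)

    maximum-principle : ∀ {f s} → (∀ u → u ≢ s → (L ▹ f) u ≤ 0ℚ) → Max f s
    maximum-principle {f} {s} sub with u , max ← argmax s f = max-walk sub (conn u s) max

    -- Every vertex may serve as the exceptional vertex `s`, so every vertex is a maximum.
    harmonic⇒constant : ∀ {f} → (∀ u → (L ▹ f) u ≡ 0ℚ) → ∀ u v → f u ≡ f v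
    harmonic⇒constant Lf u v = ℚ.≤-antisym
      (maximum-principle (λ w _ → ℚ.≤-reflexive (Lf w)) u)
      (maximum-principle (λ w _ → ℚ.≤-reflexive (Lf w)) v)

    -- Away from the source, `δ s t` is - e t, which is at most 0.
    potential-max : ∀ {s t f} → IsPotential s t f → ∀ w → f w ≤ f s
    potential-max {s} {t} (mkPotential Lf) = maximum-principle λ u u≢s → subst (_≤ 0ℚ)
      (sym (trans (Lf u) (trans (cong (_- e t u) (𝟙-false (s ≟ u) (u≢s ∘ sym))) (ℚ.+-identityˡ (- e t u)))))
      (ℚ.neg-antimono-≤ (0≤𝟙 (t ≟ u)))

    -- The negated potential has source and sink exchanged.
    potential-min : ∀ {s t f} → IsPotential s t f → ∀ w → f t ≤ f w
    potential-min {s} {t} {f} (mkPotential Lf) w = 0≤q-p⇒p≤q (subst (0ℚ ≤_)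
      (solve 2 (λ a b → :- con 1ℚ :* a :- :- con 1ℚ :* b := b :- a) refl (f t) (f w))
      (p≤q⇒0≤q-p (potential-max L-f w)))
      where
      L-f : IsPotential t s (λ k → - 1ℚ * f k)
      L-f = mkPotential λ u → trans (▹-* L (- 1ℚ) f u) (trans (cong (- 1ℚ *_) (Lf u))
        (solve 2 (λ a b → :- con 1ℚ :* (a :- b) := b :- a) refl (e s u) (e t u)))

    potential : Fin m → Fin m → Vector ℚ m
    potential s t = L † ▹ δ s t

    -- I − L L† is symmetric and is annihilated by L, so its columns are constant and so are its
    -- rows; hence it kills δ s t.
    potential-isPotential : ∀ s t → IsPotential s t (potential s t)
    potential-isPotential s t = mkPotential λ u → begin
      (L ▹ L † ▹ δ s t) u                    ≡⟨ ▹-⊗ L (L †) (δ s t) u ⟨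
      (P ▹ δ s t) u                          ≡⟨ ⟨⟩-comm (P u) (δ s t) ⟩
      ⟨ δ s t , P u ⟩                        ≡⟨ ⟨δ⟩ s t (P u) ⟩
      P u s - P u t                          ≡⟨ solve 4 (λ a b c d → a :- b := (c :- (c :- a)) :- (d :- (d :- b))) refl
                                                  (P u s) (P u t) (e u s) (e u t) ⟩
      (e u s - Z s u) - (e u t - Z t u)      ≡⟨ cong (λ z → (e u s - z) - (e u t - Z t u)) (Z-const u s t) ⟩
      (e u s - Z t u) - (e u t - Z t u)      ≡⟨ solve 3 (λ a b c → (a :- c) :- (b :- c) := a :- b) refl
                                                  (e u s) (e u t) (Z t u) ⟩
      e u s - e u t                          ≡⟨ cong₂ _-_ (e-sym u s) (e-sym u t) ⟩
      δ s t u                                ∎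
      where
      open ≡-Reasoning
      open IsMoorePenrose (†-isMoorePenrose L)
      P : Matrix m m
      P = L ⊗ L †
      Z : Fin m → Vector ℚ m
      Z k v = e v k - P v k
      L▹Z : ∀ k v → (L ▹ Z k) v ≡ 0ℚ
      L▹Z k v = begin
        ∑[ w < m ] (L v w * (e w k - P w k))
          ≡⟨ sum-cong-≗ (λ w → trans
               (cong₂ (λ a b → L v w * (a - b)) (e-sym w k) (AXsym w k))
               (solve 3 (λ a b c → a :* (b :- c) := b :* a :- c :* a) refl (L v w) (e k w) (P k w))) ⟩
        ∑[ w < m ] (e k w * L v w - P k w * L v w)
          ≡⟨ sum-- (λ w → e k w * L v w) (λ w → P k w * L v w) ⟩
        ∑[ w < m ] (e k w * L v w) - ∑[ w < m ] (P k w * L v w)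
          ≡⟨ cong₂ _-_ (sum-e k (L v)) (sum-cong-≗ (λ w → cong (P k w *_) (L-sym v w))) ⟩
        L v k - (P ⊗ L) k v     ≡⟨ cong (λ z → L v k - z) (AXA k v) ⟩
        L v k - L k v           ≡⟨ cong (λ z → L v k - z) (L-sym k v) ⟩
        L v k - L v k           ≡⟨ ℚ.+-inverseʳ (L v k) ⟩
        0ℚ                      ∎
      Z-const : ∀ u s t → Z s u ≡ Z t u
      Z-const u s t = begin
        e u s - P u s     ≡⟨ cong₂ _-_ (e-sym u s) (AXsym u s) ⟩
        Z u s             ≡⟨ harmonic⇒constant (L▹Z u) s t ⟩
        Z u t             ≡⟨ cong₂ _-_ (e-sym t u) (AXsym t u) ⟩
        e u t - P u t     ∎

    resistance-nonneg : ∀ s t → 0ℚ ≤ resistance G s t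
    resistance-nonneg s t = subst (0ℚ ≤_) (sym (resistance-potential (potential-isPotential s t)))
      (p≤q⇒0≤q-p (potential-max (potential-isPotential s t) t))

    -- The sum of potentials `f` for (u , v) and `g` for (v , w) is a potential for (u , w). Its
    -- drop is (f u - f w) + (g u - g w), where f w is at least the minimum f v and g u at most the
    -- maximum g v.
    resistance-triangle : ∀ u v w → resistance G u w ≤ resistance G u v + resistance G v w
    resistance-triangle u v w = subst₂ _≤_
      (sym (resistance-potential isPot))
      (sym (cong₂ _+_ (resistance-potential Lf) (resistance-potential Lg)))
      (subst (_≤ (f u - f v) + (g v - g w))
        (solve 4 (λ a b c d → (a :- b) :+ (c :- d) := (a :+ c) :- (b :+ d)) refl (f u) (f w) (g u) (g w))
        (ℚ.+-mono-≤ (ℚ.+-monoʳ-≤ (f u) (ℚ.neg-antimono-≤ (potential-min Lf w)))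
                    (ℚ.+-monoˡ-≤ (- g w) (potential-max Lg u))))
      where
      f = potential u v
      g = potential v w
      Lf = potential-isPotential u v
      Lg = potential-isPotential v w
      isPot : IsPotential u w (λ k → f k + g k)
      isPot = mkPotential λ k → trans (▹-+ L f g k) (trans (cong₂ _+_ (L▹≡δ Lf k) (L▹≡δ Lg k))
        (solve 3 (λ a b c → (a :- b) :+ (b :- c) := a :- c) refl (e u k) (e v k) (e w k)))

-- The cyclic order of the petals

next-cases : ∀ {n} (i : Fin n) →
  toℕ (next i) ≡ suc (toℕ i) ⊎ (toℕ (next i) ≡ 0 × suc (toℕ i) ≡ n)
next-cases {suc n} i with ℕ.m≤n⇒m<n∨m≡n (toℕ<n i)
... | inj₁ 1+i<n = inj₁ (trans (toℕ-fromℕ< _) (ℕ.m<n⇒m%n≡m 1+i<n))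
... | inj₂ 1+i≡n = inj₂
  (trans (toℕ-fromℕ< _) (trans (cong (ℕ._% suc n) 1+i≡n) (ℕ.n%n≡0 (suc n))) , 1+i≡n)

-- `next` is a cyclic shift: splitting off the last index, the others move up by one and the last
-- goes to `zero`.
sum-next : ∀ {n} (f : Vector ℚ n) → ∑[ i < n ] f (next i) ≡ sum f
sum-next {zero}  f = refl
sum-next {suc n} f = begin
  ∑[ i < suc n ] f (next i)
    ≡⟨ sum-init-last (f ∘ next) ⟩
  ∑[ i < n ] f (next (inject₁ i)) + f (next (Fin.fromℕ n))
    ≡⟨ cong₂ _+_ (sum-cong-≗ (λ i → cong f (next-inject₁ i))) (cong f next-last) ⟩
  ∑[ i < n ] f (suc i) + f zero
    ≡⟨ ℚ.+-comm (∑[ i < n ] f (suc i)) (f zero) ⟩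
  sum f ∎
  where
  open ≡-Reasoning
  next-inject₁ : (i : Fin n) → next (inject₁ i) ≡ suc i
  next-inject₁ i with next-cases (inject₁ i)
  ... | inj₁ p       = toℕ-injective (trans p (cong suc (toℕ-inject₁ i)))
  ... | inj₂ (_ , p) = contradiction (trans (sym (toℕ-inject₁ i)) (ℕ.suc-injective p)) (ℕ.<⇒≢ (toℕ<n i))
  next-last : next (Fin.fromℕ n) ≡ zero
  next-last with next-cases (Fin.fromℕ n)
  ... | inj₁ p       = contradiction (trans p (cong suc (toℕ-fromℕ n))) (ℕ.<⇒≢ (toℕ<n (next (Fin.fromℕ n))))
  ... | inj₂ (p , _) = toℕ-injective p

next≢ : ∀ {n} → 3 ℕ.≤ n → (i : Fin n) → next i ≢ i
next≢ 3≤n i eq with next-cases i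
... | inj₁ p       = ℕ.1+n≢n (trans (sym p) (cong toℕ eq))
... | inj₂ (p , q) with refl ← trans (sym q) (cong suc (trans (sym (cong toℕ eq)) p)) | s≤s () ← 3≤n

-- Without wrapping, two steps add 2. Returning after one wrap would force n = 2, and wrapping twice
-- would force n = 1.
next²≢ : ∀ {n} → 3 ℕ.≤ n → (i : Fin n) → next (next i) ≢ i
next²≢ 3≤n i eq with next-cases i | next-cases (next i)
... | inj₁ p       | inj₁ q       = ℕ.m≢1+n+m (toℕ i) (trans (sym (cong toℕ eq)) (trans q (cong suc p)))
... | inj₁ p       | inj₂ (q , s) =
  contradiction (subst (3 ℕ.≤_) (trans (sym s) (cong suc (trans p (cong suc (trans (sym (cong toℕ eq)) q))))) 3≤n) λ { (s≤s (s≤s ())) }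
... | inj₂ (p , s) | inj₁ q       =
  contradiction (subst (3 ℕ.≤_) (trans (sym s) (cong suc (trans (sym (cong toℕ eq)) (trans q (cong suc p))))) 3≤n) λ { (s≤s (s≤s ())) }
... | inj₂ (p , s) | inj₂ (q , s′) =
  contradiction (subst (3 ℕ.≤_) (trans (sym s′) (cong suc p)) 3≤n) λ { (s≤s ()) }

module Cycle (n : ℕ) .{{_ : ℕ.NonZero n}} where

  -- Indexing petals by naturals modulo `n` lets inductions on the number of steps run through the
  -- wraparound.
  [_] : ℕ → Fin n
  [ k ] = k ℕ.mod n

  toℕ-[] : ∀ k → toℕ [ k ] ≡ k ℕ.% n
  toℕ-[] k = toℕ-fromℕ< (ℕ.m%n<n k n)

  []-toℕ : ∀ i → [ toℕ i ] ≡ i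
  []-toℕ i = toℕ-injective (trans (toℕ-[] (toℕ i)) (ℕ.m<n⇒m%n≡m (toℕ<n i)))

  []-+n : ∀ k → [ k ℕ.+ n ] ≡ [ k ]
  []-+n k = toℕ-injective (trans (toℕ-[] (k ℕ.+ n)) (trans (ℕ.[m+n]%n≡m%n k n) (sym (toℕ-[] k))))

  next-[] : ∀ k → next [ k ] ≡ [ suc k ]
  next-[] k = toℕ-injective (begin
    toℕ (next [ k ])                  ≡⟨ toℕ-next [ k ] ⟩
    suc (toℕ [ k ]) ℕ.% n             ≡⟨ cong (λ j → suc j ℕ.% n) (toℕ-[] k) ⟩
    (1 ℕ.+ k ℕ.% n) ℕ.% n             ≡⟨ ℕ.%-distribˡ-+ 1 (k ℕ.% n) n ⟩
    (1 ℕ.% n ℕ.+ k ℕ.% n ℕ.% n) ℕ.% n ≡⟨ cong (λ j → (1 ℕ.% n ℕ.+ j) ℕ.% n) (ℕ.m%n%n≡m%n k n) ⟩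
    (1 ℕ.% n ℕ.+ k ℕ.% n) ℕ.% n       ≡⟨ ℕ.%-distribˡ-+ 1 k n ⟨
    suc k ℕ.% n                       ≡⟨ toℕ-[] (suc k) ⟨
    toℕ [ suc k ]                     ∎)
    where
    open ≡-Reasoning
    toℕ-next : (i : Fin n) → toℕ (next i) ≡ suc (toℕ i) ℕ.% n
    toℕ-next i with next-cases i
    ... | inj₁ p       = trans p (sym (ℕ.m<n⇒m%n≡m (subst (ℕ._< n) p (toℕ<n (next i)))))
    ... | inj₂ (p , q) = trans p (sym (trans (cong (ℕ._% n) q) (ℕ.n%n≡0 n)))

  N : ℚ
  N = fromℕ n

  -- The number of steps of next from i to j.
  dist : Fin n → Fin n → ℚ
  dist i j = fromℕ (toℕ j) - fromℕ (toℕ i) + 𝟙 (toℕ j ℕ.<? toℕ i) * N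

  -- Serves both cases of `dist-steps`: `c` is `n` if the walk wraps around and 0 otherwise, and `w`
  -- is the matching value of the indicator.
  dist-unique : ∀ {i j : Fin n} k {c w} → fromℕ (k ℕ.+ toℕ i) ≡ fromℕ (toℕ j) + c →
                𝟙 (toℕ j ℕ.<? toℕ i) ≡ w → c ≡ w * N → fromℕ k ≡ dist i j
  dist-unique {i} {j} k {c} {w} k+i ind c≡ = begin
    fromℕ k                                       ≡⟨ solve 2 (λ a b → a := a :+ b :- b) refl (fromℕ k) (fromℕ (toℕ i)) ⟩
    fromℕ k + fromℕ (toℕ i) - fromℕ (toℕ i)       ≡⟨ cong (_- fromℕ (toℕ i)) (trans (sym (fromℕ-+ k (toℕ i))) k+i) ⟩
    fromℕ (toℕ j) + c - fromℕ (toℕ i)             ≡⟨ solve 3 (λ a b c → a :+ b :- c := a :- c :+ b) refl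
                                                       (fromℕ (toℕ j)) c (fromℕ (toℕ i)) ⟩
    fromℕ (toℕ j) - fromℕ (toℕ i) + c             ≡⟨ cong (fromℕ (toℕ j) - fromℕ (toℕ i) +_)
                                                       (trans c≡ (cong (_* N) (sym ind))) ⟩
    dist i j                                      ∎
    where open ≡-Reasoning

  dist-steps : ∀ i j → ∃ λ k → [ k ℕ.+ toℕ i ] ≡ j × fromℕ k ≡ dist i j
  dist-steps i j with toℕ j ℕ.<? toℕ i
  ... | yes j<i = k , trans (cong [_] k+i) (trans ([]-+n (toℕ j)) ([]-toℕ j))
      , dist-unique k (trans (cong fromℕ k+i) (fromℕ-+ (toℕ j) n)) (𝟙-true (toℕ j ℕ.<? toℕ i) j<i) (sym (ℚ.*-identityˡ N))
    where
    open ≡-Reasoning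
    -- From `i` up to the wraparound, then on to `j`; the truncated subtraction is exact because i <
    -- n.
    k = n ℕ.∸ toℕ i ℕ.+ toℕ j
    k+i : k ℕ.+ toℕ i ≡ toℕ j ℕ.+ n
    k+i = begin
      n ℕ.∸ toℕ i ℕ.+ toℕ j ℕ.+ toℕ i    ≡⟨ cong (ℕ._+ toℕ i) (ℕ.+-comm (n ℕ.∸ toℕ i) (toℕ j)) ⟩
      toℕ j ℕ.+ (n ℕ.∸ toℕ i) ℕ.+ toℕ i  ≡⟨ ℕ.+-assoc (toℕ j) (n ℕ.∸ toℕ i) (toℕ i) ⟩
      toℕ j ℕ.+ (n ℕ.∸ toℕ i ℕ.+ toℕ i)  ≡⟨ cong (toℕ j ℕ.+_) (ℕ.m∸n+n≡m (ℕ.<⇒≤ (toℕ<n i))) ⟩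
      toℕ j ℕ.+ n                        ∎
  ... | no j≮i = k , trans (cong [_] k+i) ([]-toℕ j)
      , dist-unique k (trans (cong fromℕ k+i) (sym (ℚ.+-identityʳ (fromℕ (toℕ j))))) (𝟙-false (toℕ j ℕ.<? toℕ i) j≮i) (sym (ℚ.*-zeroˡ N))
    where
    k = toℕ j ℕ.∸ toℕ i
    k+i : k ℕ.+ toℕ i ≡ toℕ j
    k+i = ℕ.m∸n+n≡m (ℕ.≮⇒≥ j≮i)

  dist-refl : ∀ i → dist i i ≡ 0ℚ
  dist-refl i = trans
    (cong (λ z → fromℕ (toℕ i) - fromℕ (toℕ i) + z * N) (𝟙-false (toℕ i ℕ.<? toℕ i) (ℕ.<-irrefl refl)))
    (solve 2 (λ a b → a :- a :+ con 0ℚ :* b := con 0ℚ) refl (fromℕ (toℕ i)) N)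

  -- The right side says i ≤ j in the form i < j + 1, which is the shape needed when passing from
  -- petal `j` to its successor.
  𝟙<+e : ∀ (i j : Fin n) → 𝟙 (toℕ i ℕ.<? toℕ j) + e i j ≡ 𝟙 (toℕ i ℕ.<? suc (toℕ j))
  𝟙<+e i j with i ≟ j
  ... | yes refl = trans (cong (_+ 1ℚ) (𝟙-false (toℕ i ℕ.<? toℕ i) (ℕ.<-irrefl refl)))
                         (sym (𝟙-true (toℕ i ℕ.<? suc (toℕ i)) ℕ.≤-refl))
  ... | no  i≢j  = trans (ℚ.+-identityʳ _) (𝟙-cong (toℕ i ℕ.<? toℕ j) (toℕ i ℕ.<? suc (toℕ j))
                     ℕ.m<n⇒m<1+n (λ i≤j → ℕ.≤∧≢⇒< (ℕ.≤-pred i≤j) (i≢j ∘ toℕ-injective)))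

  -- The differences of indices cancel. What is left counts which of j < i and i < j holds: exactly
  -- one, unless i = j.
  dist-+ : ∀ i j → dist i j + dist j i ≡ N * (1ℚ - e i j)
  dist-+ i j = trans
    (solve 5 (λ a b c d q → (a :- b :+ c :* q) :+ (b :- a :+ d :* q) := q :* (c :+ d)) refl
      (fromℕ (toℕ j)) (fromℕ (toℕ i)) (𝟙 (toℕ j ℕ.<? toℕ i)) (𝟙 (toℕ i ℕ.<? toℕ j)) N)
    (cong (N *_) (trans
      (solve 3 (λ a b c → a :+ b := a :+ (b :+ c) :- c) refl
        (𝟙 (toℕ j ℕ.<? toℕ i)) (𝟙 (toℕ i ℕ.<? toℕ j)) (e i j))
      (cong (_- e i j) (trans (cong (𝟙 (toℕ j ℕ.<? toℕ i) +_) (𝟙<+e i j)) tricho))))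
    where
    tricho : 𝟙 (toℕ j ℕ.<? toℕ i) + 𝟙 (toℕ i ℕ.<? suc (toℕ j)) ≡ 1ℚ
    tricho with ℕ.<-≤-connex (toℕ j) (toℕ i)
    ... | inj₁ j<i = cong₂ _+_ (𝟙-true (toℕ j ℕ.<? toℕ i) j<i)
                              (𝟙-false (toℕ i ℕ.<? suc (toℕ j)) (λ i≤j → ℕ.<⇒≱ j<i (ℕ.≤-pred i≤j)))
    ... | inj₂ i≤j = cong₂ _+_ (𝟙-false (toℕ j ℕ.<? toℕ i) (ℕ.≤⇒≯ i≤j))
                              (𝟙-true (toℕ i ℕ.<? suc (toℕ j)) (s≤s i≤j))

  -- Adding the sum to its transpose turns each row into a sum of `dist-+`. This is the source of
  -- the factor n³ - n² in the upper bound.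
  sum-dist : ∑[ i < n ] ∑[ j < n ] dist i j ≡ ½ * (N * (N * (N - 1ℚ)))
  sum-dist = begin
    D                                              ≡⟨ solve 1 (λ a → a := con ½ :* (a :+ a)) refl D ⟩
    ½ * (D + D)                                    ≡⟨ cong (λ z → ½ * (D + z)) (∑-comm dist) ⟩
    ½ * (D + ∑[ i < n ] ∑[ j < n ] dist j i)       ≡⟨ cong (½ *_) (∑-distrib-+ _ (λ i → ∑[ j < n ] dist j i)) ⟨
    ½ * (∑[ i < n ] (∑[ j < n ] dist i j + ∑[ j < n ] dist j i))
      ≡⟨ cong (½ *_) (trans (sum-cong-≗ row) (sum-const n (N * (N - 1ℚ)))) ⟩
    ½ * (N * (N * (N - 1ℚ)))                       ∎
    where
    open ≡-Reasoning
    D = ∑[ i < n ] ∑[ j < n ] dist i j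
    row : ∀ i → ∑[ j < n ] dist i j + ∑[ j < n ] dist j i ≡ N * (N - 1ℚ)
    row i = begin
      ∑[ j < n ] dist i j + ∑[ j < n ] dist j i   ≡⟨ ∑-distrib-+ (dist i) (λ j → dist j i) ⟨
      ∑[ j < n ] (dist i j + dist j i)            ≡⟨ sum-cong-≗ (dist-+ i) ⟩
      ∑[ j < n ] (N * (1ℚ - e i j))               ≡⟨ *-distribˡ-sum N (λ j → 1ℚ - e i j) ⟨
      N * ∑[ j < n ] (1ℚ - e i j)                 ≡⟨ cong (N *_) (sum-1-e i) ⟩
      N * (N - 1ℚ)                                ∎

-- Final rearrangements, with `S` the resistance sum over ordered pairs of G

upper-arith : ∀ S N M r →
  ½ * (N * S + (N * (N - 1ℚ)) * (M * S) + M * M * r * (½ * (N * (N * (N - 1ℚ)))))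
  ≡ ½ * S * (N + N * M * (N - 1ℚ)) + r * (N * N * N - N * N) * (M * M) * (ℤ.+ 1 / 4)
upper-arith = solve 4 (λ S N M r →
  con ½ :* (N :* S :+ (N :* (N :- con 1ℚ)) :* (M :* S) :+ M :* M :* r :* (con ½ :* (N :* (N :* (N :- con 1ℚ)))))
  := con ½ :* S :* (N :+ N :* M :* (N :- con 1ℚ)) :+ r :* (N :* N :* N :- N :* N) :* (M :* M) :* con (ℤ.+ 1 / 4)) refl

lower-arith : ∀ N S M r {ν} → N * ν ≡ 1ℚ →
  N * (½ * S) - M * (M - 1ℚ) * r * ½ ≡ ½ * (N * (S - M * ((M - 1ℚ) * (ν * r))))
lower-arith N S M r {ν} Nν≡1 = begin
  N * (½ * S) - M * (M - 1ℚ) * r * ½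
    ≡⟨ solve 4 (λ N S M r → N :* (con ½ :* S) :- M :* (M :- con 1ℚ) :* r :* con ½
         -- The explicit factor 1 is a placeholder, rewritten to `N * ν` in the next step.
         := con ½ :* (N :* S :- con 1ℚ :* (M :* ((M :- con 1ℚ) :* r)))) refl N S M r ⟩
  ½ * (N * S - 1ℚ * (M * ((M - 1ℚ) * r)))
    ≡⟨ cong (λ z → ½ * (N * S - z * (M * ((M - 1ℚ) * r)))) Nν≡1 ⟨
  ½ * (N * S - N * ν * (M * ((M - 1ℚ) * r)))
    ≡⟨ solve 5 (λ N S M r ν → con ½ :* (N :* S :- N :* ν :* (M :* ((M :- con 1ℚ) :* r)))
         := con ½ :* (N :* (S :- M :* ((M :- con 1ℚ) :* (ν :* r))))) refl N S M r ν ⟩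
  ½ * (N * (S - M * ((M - 1ℚ) * (ν * r)))) ∎
  where open ≡-Reasoning

-- The flower

module Flower {m} {x y : Fin m} (x≢y : x ≢ y) {n} (3≤n : 3 ℕ.≤ n) where

  V : ℕ
  V = n ℕ.* pred m

  γ : Fin n → Fin m → Fin V
  γ = glue x≢y

  F : Graph m → Graph V
  F G = flower n 3≤n G x y x≢y

  -- For n ≥ 3 distinct petals share at most one vertex: two common vertices would give `next` a
  -- fixed point or a cycle of length two.
  glue-pair-injective : ∀ {i j a b a′ b′} → γ i a ≡ γ j a′ → γ i b ≡ γ j b′ → a ≢ b → i ≡ j × a ≡ a′ × b ≡ b′
  glue-pair-injective {i} {j} {a} {b} {a′} {b′} p q a≢b
    with glue-fibre x≢y i j a a′ p | glue-fibre x≢y i j b b′ q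
  ... | inj₁ (i≡j , a≡a′)           | inj₁ (_ , b≡b′)              = i≡j , a≡a′ , b≡b′
  ... | inj₁ (refl , _)             | inj₂ (inj₁ (_ , j≡ , _))     = contradiction (sym j≡) (next≢ 3≤n i)
  ... | inj₁ (refl , _)             | inj₂ (inj₂ (_ , i≡ , _))     = contradiction (sym i≡) (next≢ 3≤n i)
  ... | inj₂ (inj₁ (_ , j≡ , _))    | inj₁ (refl , _)              = contradiction (sym j≡) (next≢ 3≤n i)
  ... | inj₂ (inj₂ (_ , i≡ , _))    | inj₁ (refl , _)              = contradiction (sym i≡) (next≢ 3≤n i)
  ... | inj₂ (inj₁ (a≡y , _))       | inj₂ (inj₁ (b≡y , _))        = contradiction (trans a≡y (sym b≡y)) a≢b
  ... | inj₂ (inj₁ (_ , refl , _))  | inj₂ (inj₂ (_ , i≡ , _))     = contradiction (sym i≡) (next²≢ 3≤n i)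
  ... | inj₂ (inj₂ (_ , i≡ , _))    | inj₂ (inj₁ (_ , refl , _))   = contradiction (sym i≡) (next²≢ 3≤n i)
  ... | inj₂ (inj₂ (_ , _ , a≡x))   | inj₂ (inj₂ (_ , _ , b≡x))    = contradiction (trans a≡x (sym b≡x)) a≢b

  -- A function on the quotient, defined on the representatives chosen by `glue-surjective`;
  -- `glue-fibre` shows that agreement at the joints makes the choice immaterial.
  extend : (f : Fin n → Vector ℚ m) → (∀ i → f i y ≡ f (next i) x) → ∃ λ (g : Vector ℚ V) → ∀ i a → g (γ i a) ≡ f i a
  extend f compat = (λ u → let i , a , _ = glue-surjective x≢y u in f i a) , λ i a →
    let j , b , eq = glue-surjective x≢y (γ i a) in agree (glue-fibre x≢y j i b a eq)
    where
    agree : ∀ {i j a b} → (j ≡ i × b ≡ a) ⊎ (b ≡ y × i ≡ next j × a ≡ x) ⊎ (a ≡ y × j ≡ next i × b ≡ x) → f j b ≡ f i a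
    agree         (inj₁ (refl , refl))               = refl
    agree {j = j} (inj₂ (inj₁ (refl , refl , refl))) = compat j
    agree {i}     (inj₂ (inj₂ (refl , refl , refl))) = sym (compat i)

  -- Every vertex of the flower is hit at least once by `γ`, and joints are hit twice.
  sum≤sum-glue : ∀ {f : Vector ℚ V} → (∀ u → 0ℚ ≤ f u) → sum f ≤ ∑[ i < n ] ∑[ a < m ] f (γ i a)
  sum≤sum-glue {f} 0≤f = ℚ.≤-trans (sum-mono covered) (ℚ.≤-reflexive (begin
    ∑[ u < V ] ∑[ i < n ] ∑[ a < m ] (e (γ i a) u * f u)   ≡⟨ ∑-comm (λ u i → ∑[ a < m ] (e (γ i a) u * f u)) ⟩
    ∑[ i < n ] ∑[ u < V ] ∑[ a < m ] (e (γ i a) u * f u)   ≡⟨ sum-cong-≗ (λ i → ∑-comm (λ u a → e (γ i a) u * f u)) ⟩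
    ∑[ i < n ] ∑[ a < m ] ∑[ u < V ] (e (γ i a) u * f u)   ≡⟨ sum-cong-≗ (λ i → sum-cong-≗ λ a → sum-e (γ i a) f) ⟩
    ∑[ i < n ] ∑[ a < m ] f (γ i a)                        ∎))
    where
    open ≡-Reasoning
    0≤term : ∀ u i a → 0ℚ ≤ e (γ i a) u * f u
    0≤term u i a = 0≤* (0≤𝟙 (γ i a ≟ u)) (0≤f u)
    covered : ∀ u → f u ≤ ∑[ i < n ] ∑[ a < m ] (e (γ i a) u * f u)
    covered u = let i , a , eq = glue-surjective x≢y u in ℚ.≤-trans
      (ℚ.≤-reflexive (sym (trans (cong (_* f u) (𝟙-true (γ i a ≟ u) eq)) (ℚ.*-identityˡ (f u)))))
      (ℚ.≤-trans (term≤sum (0≤term u i) a) (term≤sum (λ j → sum-nonneg (0≤term u j)) i))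

  -- Adjacency and Laplacian of the flower as sums over petals

  module _ (G : Graph m) where
    open Graph G

    -- For adjacent `u` and `v` exactly one triple (i , a , b) contributes, since no edge comes from
    -- two petals.
    adjacency-flower : ∀ u v → adjacency (F G) u v ≡
      ∑[ i < n ] ∑[ a < m ] ∑[ b < m ] (e (γ i a) u * (e (γ i b) v * adjacency G a b))
    adjacency-flower u v with Graph.adj? (F G) u v
    ... | no ¬uv = sym (sum-zero λ i → sum-zero λ a → sum-zero λ b →
      trans (sym (edge≡ i a b)) (𝟙-false (edge? i a b) λ (p , q , ab) → ¬uv (i , a , b , p , q , ab)))
      where
      edge? : ∀ i a b → Dec (γ i a ≡ u × γ i b ≡ v × Adj a b)
      edge? i a b = (γ i a ≟ u) ×-dec ((γ i b ≟ v) ×-dec adj? a b)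
      edge≡ : ∀ i a b → 𝟙 (edge? i a b) ≡ e (γ i a) u * (e (γ i b) v * adjacency G a b)
      edge≡ i a b = trans (𝟙-× (γ i a ≟ u) ((γ i b ≟ v) ×-dec adj? a b))
                          (cong (e (γ i a) u *_) (𝟙-× (γ i b ≟ v) (adj? a b)))
    ... | yes (i₀ , a₀ , b₀ , p₀ , q₀ , ab₀) = sym (begin
      ∑[ i < n ] ∑[ a < m ] ∑[ b < m ] (e (γ i a) u * (e (γ i b) v * adjacency G a b))
        ≡⟨ sum-cong-≗ (λ i → sum-cong-≗ λ a → sum-cong-≗ λ b → unique i a b) ⟩
      ∑[ i < n ] ∑[ a < m ] ∑[ b < m ] (e i₀ i * (e a₀ a * e b₀ b))
        ≡⟨ sum-cong-≗ (λ i → sum-cong-≗ λ a → trans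
             (sym (*-distribˡ-sum (e i₀ i) (λ b → e a₀ a * e b₀ b)))
             (cong (e i₀ i *_) (trans (sym (*-distribˡ-sum (e a₀ a) (e b₀)))
               (cong (e a₀ a *_) (sum-e-const b₀))))) ⟩
      ∑[ i < n ] ∑[ a < m ] (e i₀ i * (e a₀ a * 1ℚ))
        ≡⟨ sum-cong-≗ (λ i → trans (sym (*-distribˡ-sum (e i₀ i) (λ a → e a₀ a * 1ℚ)))
             (cong (e i₀ i *_) (sum-e a₀ (λ _ → 1ℚ)))) ⟩
      ∑[ i < n ] (e i₀ i * 1ℚ)
        ≡⟨ sum-e i₀ (λ _ → 1ℚ) ⟩
      1ℚ ∎)
      where
      open ≡-Reasoning
      -- The summand is the indicator of a conjunction equivalent to (i , a , b) = (i₀ , a₀ , b₀);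
      -- irreflexivity supplies the distinctness required by `glue-pair-injective`.
      unique : ∀ i a b → e (γ i a) u * (e (γ i b) v * adjacency G a b) ≡ e i₀ i * (e a₀ a * e b₀ b)
      unique i a b = begin
        e (γ i a) u * (e (γ i b) v * adjacency G a b)
          ≡⟨ cong (e (γ i a) u *_) (𝟙-× (γ i b ≟ v) (adj? a b)) ⟨
        e (γ i a) u * 𝟙 ((γ i b ≟ v) ×-dec adj? a b)
          ≡⟨ 𝟙-× (γ i a ≟ u) ((γ i b ≟ v) ×-dec adj? a b) ⟨
        𝟙 ((γ i a ≟ u) ×-dec ((γ i b ≟ v) ×-dec adj? a b))
          ≡⟨ 𝟙-cong ((γ i a ≟ u) ×-dec ((γ i b ≟ v) ×-dec adj? a b)) ((i₀ ≟ i) ×-dec ((a₀ ≟ a) ×-dec (b₀ ≟ b)))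
               (λ (p , q , _) → glue-pair-injective (trans p₀ (sym p)) (trans q₀ (sym q)) (λ a≡b → adj-irrefl a≡b ab₀))
               (λ { (refl , refl , refl) → p₀ , q₀ , ab₀ }) ⟩
        𝟙 ((i₀ ≟ i) ×-dec ((a₀ ≟ a) ×-dec (b₀ ≟ b)))
          ≡⟨ 𝟙-× (i₀ ≟ i) ((a₀ ≟ a) ×-dec (b₀ ≟ b)) ⟩
        e i₀ i * 𝟙 ((a₀ ≟ a) ×-dec (b₀ ≟ b))
          ≡⟨ cong (e i₀ i *_) (𝟙-× (a₀ ≟ a) (b₀ ≟ b)) ⟩
        e i₀ i * (e a₀ a * e b₀ b) ∎

    edge-sum : ∀ u (φ : Vector ℚ V) → ∑[ v < V ] (adjacency (F G) u v * φ v) ≡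
      ∑[ i < n ] ∑[ a < m ] (e (γ i a) u * ∑[ b < m ] (adjacency G a b * φ (γ i b)))
    edge-sum u φ = begin
      ∑[ v < V ] (adjacency (F G) u v * φ v)
        ≡⟨ sum-cong-≗ (λ v → trans (cong (_* φ v) (adjacency-flower u v)) (distrib v)) ⟩
      ∑[ v < V ] ∑[ i < n ] ∑[ a < m ] ∑[ b < m ] (T i a b v * φ v)
        ≡⟨ ∑-comm (λ v i → ∑[ a < m ] ∑[ b < m ] (T i a b v * φ v)) ⟩
      ∑[ i < n ] ∑[ v < V ] ∑[ a < m ] ∑[ b < m ] (T i a b v * φ v)
        ≡⟨ sum-cong-≗ (λ i → ∑-comm (λ v a → ∑[ b < m ] (T i a b v * φ v))) ⟩
      ∑[ i < n ] ∑[ a < m ] ∑[ v < V ] ∑[ b < m ] (T i a b v * φ v)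
        ≡⟨ sum-cong-≗ (λ i → sum-cong-≗ λ a → ∑-comm (λ v b → T i a b v * φ v)) ⟩
      ∑[ i < n ] ∑[ a < m ] ∑[ b < m ] ∑[ v < V ] (T i a b v * φ v)
        ≡⟨ sum-cong-≗ (λ i → sum-cong-≗ λ a → trans (sum-cong-≗ λ b → collapse i a b)
             (sym (*-distribˡ-sum (e (γ i a) u) (λ b → adjacency G a b * φ (γ i b))))) ⟩
      ∑[ i < n ] ∑[ a < m ] (e (γ i a) u * ∑[ b < m ] (adjacency G a b * φ (γ i b))) ∎
      where
      open ≡-Reasoning
      T : Fin n → Fin m → Fin m → Vector ℚ V
      T i a b v = e (γ i a) u * (e (γ i b) v * adjacency G a b)
      distrib : ∀ v → (∑[ i < n ] ∑[ a < m ] ∑[ b < m ] T i a b v) * φ v ≡ ∑[ i < n ] ∑[ a < m ] ∑[ b < m ] (T i a b v * φ v)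
      distrib v = trans (*-distribʳ-sum (φ v) (λ i → ∑[ a < m ] ∑[ b < m ] T i a b v))
        (sum-cong-≗ λ i → trans (*-distribʳ-sum (φ v) (λ a → ∑[ b < m ] T i a b v))
          (sum-cong-≗ λ a → *-distribʳ-sum (φ v) (λ b → T i a b v)))
      collapse : ∀ i a b → ∑[ v < V ] (T i a b v * φ v) ≡ e (γ i a) u * (adjacency G a b * φ (γ i b))
      collapse i a b = trans
        (sum-cong-≗ λ v → solve 4 (λ p q r s → p :* (q :* r) :* s := q :* (p :* (r :* s))) refl
          (e (γ i a) u) (e (γ i b) v) (adjacency G a b) (φ v))
        (sum-e (γ i b) (λ v → e (γ i a) u * (adjacency G a b * φ v)))

    -- In the lower bound this is applied to the complete graph, where it sums over the pairs inside
    -- the petals.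
    edge-sum₂ : ∀ (φ : Fin V → Fin V → ℚ) → ∑[ u < V ] ∑[ v < V ] (adjacency (F G) u v * φ u v) ≡
      ∑[ i < n ] ∑[ a < m ] ∑[ b < m ] (adjacency G a b * φ (γ i a) (γ i b))
    edge-sum₂ φ = begin
      ∑[ u < V ] ∑[ v < V ] (adjacency (F G) u v * φ u v)      ≡⟨ sum-cong-≗ (λ u → edge-sum u (φ u)) ⟩
      ∑[ u < V ] ∑[ i < n ] ∑[ a < m ] (e (γ i a) u * ψ i a u) ≡⟨ ∑-comm (λ u i → ∑[ a < m ] (e (γ i a) u * ψ i a u)) ⟩
      ∑[ i < n ] ∑[ u < V ] ∑[ a < m ] (e (γ i a) u * ψ i a u) ≡⟨ sum-cong-≗ (λ i → ∑-comm (λ u a → e (γ i a) u * ψ i a u)) ⟩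
      ∑[ i < n ] ∑[ a < m ] ∑[ u < V ] (e (γ i a) u * ψ i a u) ≡⟨ sum-cong-≗ (λ i → sum-cong-≗ λ a → sum-e (γ i a) (ψ i a)) ⟩
      ∑[ i < n ] ∑[ a < m ] ψ i a (γ i a)                      ∎
      where
      open ≡-Reasoning
      ψ : Fin n → Fin m → Vector ℚ V
      ψ i a u = ∑[ b < m ] (adjacency G a b * φ u (γ i b))

    -- The edge set of the flower is the disjoint union of those of the petals, so its Laplacian is
    -- the sum of the petal Laplacians pushed forward along `γ i`.
    laplacian-flower : ∀ f u → (laplacian (F G) ▹ f) u ≡ ∑[ i < n ] ∑[ a < m ] (e (γ i a) u * (laplacian G ▹ (f ∘ γ i)) a)
    laplacian-flower f u = begin
      (laplacian (F G) ▹ f) u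
        ≡⟨ Potential.L▹≡ (F G) f u ⟩
      ∑[ v < V ] (adjacency (F G) u v * (f u - f v))
        ≡⟨ edge-sum u (λ v → f u - f v) ⟩
      ∑[ i < n ] ∑[ a < m ] (e (γ i a) u * ψ i a u)
        ≡⟨ sum-cong-≗ (λ i → sum-cong-≗ λ a → trans (e-subst (γ i a) u (ψ i a))
             (cong (e (γ i a) u *_) (sym (Potential.L▹≡ G (f ∘ γ i) a)))) ⟩
      ∑[ i < n ] ∑[ a < m ] (e (γ i a) u * (laplacian G ▹ (f ∘ γ i)) a) ∎
      where
      open ≡-Reasoning
      ψ : Fin n → Fin m → Vector ℚ V
      ψ i a w = ∑[ b < m ] (adjacency G a b * (f w - f (γ i b)))

  -- Resistances within a petal

  module _ (G : Graph m) (conn : Connected G) where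
    open Potential
    open Cycle n {{ℕ.>-nonZero (ℕ.≤-trans (s≤s z≤n) 3≤n)}}

    r : ℚ
    r = resistance G x y

    ρ : Fin V → Fin V → ℚ
    ρ = resistance (F G)

    -- By balance, the voltage drops around the cycle, α (h x − h y) in each petal and an extra g x − g y
    -- in the petal i₀, add up to zero.
    module Circulation (i₀ : Fin n) (a₀ b₀ : Fin m) (α : ℚ)
      {g h : Vector ℚ m} (Lg : IsPotential G a₀ b₀ g) (Lh : IsPotential G x y h)
      (balance : N * (α * (h x - h y)) ≡ - (g x - g y)) where

      t : ℚ
      t = g x - g y

      ι : Fin n → ℚ
      ι j = fromℕ (toℕ j)

      -- The first summand cancels the value at x, and the second is the drop accumulated since
      -- petal 0: `k` petals have been crossed, and `l` records whether `i₀` was among them.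
      offset : ℚ → ℚ → ℚ → ℚ
      offset η k l = - (α * h x + η * g x) + - (k * (α * (h x - h y)) + l * t)

      κ : Vector ℚ n
      κ j = offset (e i₀ j) (ι j) (𝟙 (toℕ i₀ ℕ.<? toℕ j))

      f : Fin n → Vector ℚ m
      f j k = α * h k + e i₀ j * g k + κ j

      compat : ∀ j → f j y ≡ f (next j) x
      compat j = begin
        f j y
          ≡⟨ solve 8 (λ α η hx hy gx gy k l →
               α :* hy :+ η :* gy :+ (:- (α :* hx :+ η :* gx) :+ :- (k :* (α :* (hx :- hy)) :+ l :* (gx :- gy)))
               := :- ((con 1ℚ :+ k) :* (α :* (hx :- hy)) :+ (l :+ η) :* (gx :- gy))) refl
               α (e i₀ j) (h x) (h y) (g x) (g y) (ι j) (𝟙 (toℕ i₀ ℕ.<? toℕ j)) ⟩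
        - ((1ℚ + ι j) * D + (𝟙 (toℕ i₀ ℕ.<? toℕ j) + e i₀ j) * t)
          ≡⟨ cong₂ (λ a b → - (a * D + b * t)) (sym (fromℕ-suc (toℕ j))) (𝟙<+e i₀ j) ⟩
        - (fromℕ (suc (toℕ j)) * D + 𝟙 (toℕ i₀ ℕ.<? suc (toℕ j)) * t)
          ≡⟨ wrap (next-cases j) ⟩
        - (ι (next j) * D + 𝟙 (toℕ i₀ ℕ.<? toℕ (next j)) * t)
          ≡⟨ solve 2 (λ p q → :- q := p :+ (:- p :+ :- q)) refl
               (α * h x + e i₀ (next j) * g x) (ι (next j) * D + 𝟙 (toℕ i₀ ℕ.<? toℕ (next j)) * t) ⟩
        f (next j) x ∎
        where
        open ≡-Reasoning
        D : ℚ
        D = α * (h x - h y)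
        drop : ℕ → ℚ
        drop k = - (fromℕ k * D + 𝟙 (toℕ i₀ ℕ.<? k) * t)
        wrap : toℕ (next j) ≡ suc (toℕ j) ⊎ (toℕ (next j) ≡ 0 × suc (toℕ j) ≡ n) →
               drop (suc (toℕ j)) ≡ drop (toℕ (next j))
        wrap (inj₁ p)       = cong drop (sym p)
        -- After the last petal the accumulated drop has to return to zero, which is `balance`.
        wrap (inj₂ (p , q)) = begin
          drop (suc (toℕ j))     ≡⟨ cong drop q ⟩
          drop n                 ≡⟨ cong₂ (λ a b → - (a + b * t)) balance (𝟙-true (toℕ i₀ ℕ.<? n) (toℕ<n i₀)) ⟩
          - (- t + 1ℚ * t)       ≡⟨ solve 2 (λ t d → :- (:- t :+ con 1ℚ :* t) := :- (con 0ℚ :* d :+ con 0ℚ :* t)) refl t D ⟩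
          - (0ℚ * D + 0ℚ * t)    ≡⟨ cong drop p ⟨
          drop (toℕ (next j))    ∎

      f̂ : Vector ℚ V
      f̂ = proj₁ (extend f compat)

      f̂-glue : ∀ i a → f̂ (γ i a) ≡ f i a
      f̂-glue = proj₂ (extend f compat)

      L▹f : ∀ i a → (laplacian G ▹ (f̂ ∘ γ i)) a ≡ α * δ x y a + e i₀ i * δ a₀ b₀ a
      L▹f i a = begin
        (L G ▹ (f̂ ∘ γ i)) a
          ≡⟨ ▹-cong (L G) (f̂-glue i) a ⟩
        (L G ▹ (λ k → α * h k + e i₀ i * g k + κ i)) a
          ≡⟨ ▹-+ (L G) (λ k → α * h k + e i₀ i * g k) (λ _ → κ i) a ⟩
        (L G ▹ (λ k → α * h k + e i₀ i * g k)) a + (L G ▹ (λ _ → κ i)) a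
          ≡⟨ cong₂ _+_ (▹-+ (L G) (λ k → α * h k) (λ k → e i₀ i * g k) a) (L▹const G (κ i) a) ⟩
        (L G ▹ (λ k → α * h k)) a + (L G ▹ (λ k → e i₀ i * g k)) a + 0ℚ
          ≡⟨ ℚ.+-identityʳ _ ⟩
        (L G ▹ (λ k → α * h k)) a + (L G ▹ (λ k → e i₀ i * g k)) a
          ≡⟨ cong₂ _+_ (trans (▹-* (L G) α h a) (cong (α *_) (L▹≡δ Lh a)))
                       (trans (▹-* (L G) (e i₀ i) g a) (cong (e i₀ i *_) (L▹≡δ Lg a))) ⟩
        α * δ x y a + e i₀ i * δ a₀ b₀ a ∎
        where open ≡-Reasoning

      -- The α-terms form a current circulating through all petals: it cancels at every joint, and
      -- only the source and sink in `i₀` survive.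
      f̂-potential : IsPotential (F G) (γ i₀ a₀) (γ i₀ b₀) f̂
      f̂-potential = mkPotential λ u → begin
        (L (F G) ▹ f̂) u
          ≡⟨ laplacian-flower G f̂ u ⟩
        ∑[ i < n ] ∑[ a < m ] (e (γ i a) u * (laplacian G ▹ (f̂ ∘ γ i)) a)
          ≡⟨ sum-cong-≗ (λ i → trans (sum-cong-≗ λ a → cong (e (γ i a) u *_) (L▹f i a)) (petal-sum u i)) ⟩
        ∑[ i < n ] (α * (e (γ i x) u - e (γ i y) u) + e i₀ i * (e (γ i a₀) u - e (γ i b₀) u))
          ≡⟨ ∑-distrib-+ (λ i → α * (e (γ i x) u - e (γ i y) u)) (λ i → e i₀ i * (e (γ i a₀) u - e (γ i b₀) u)) ⟩
        ∑[ i < n ] (α * (e (γ i x) u - e (γ i y) u)) + ∑[ i < n ] (e i₀ i * (e (γ i a₀) u - e (γ i b₀) u))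
          ≡⟨ cong₂ _+_ (sym (*-distribˡ-sum α (λ i → e (γ i x) u - e (γ i y) u)))
                       (sum-e i₀ (λ i → e (γ i a₀) u - e (γ i b₀) u)) ⟩
        α * ∑[ i < n ] (e (γ i x) u - e (γ i y) u) + δ (γ i₀ a₀) (γ i₀ b₀) u
          ≡⟨ cong (λ z → α * z + δ (γ i₀ a₀) (γ i₀ b₀) u) (telescope u) ⟩
        α * 0ℚ + δ (γ i₀ a₀) (γ i₀ b₀) u
          ≡⟨ solve 2 (λ a b → a :* con 0ℚ :+ b := b) refl α (δ (γ i₀ a₀) (γ i₀ b₀) u) ⟩
        δ (γ i₀ a₀) (γ i₀ b₀) u ∎
        where
        open ≡-Reasoning
        petal-sum : ∀ u i → ∑[ a < m ] (e (γ i a) u * (α * δ x y a + e i₀ i * δ a₀ b₀ a))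
                          ≡ α * (e (γ i x) u - e (γ i y) u) + e i₀ i * (e (γ i a₀) u - e (γ i b₀) u)
        petal-sum u i = begin
          ∑[ a < m ] (P a * (α * δ x y a + η * δ a₀ b₀ a))
            ≡⟨ sum-cong-≗ (λ a → solve 5 (λ p α d η d′ → p :* (α :* d :+ η :* d′) := α :* (d :* p) :+ η :* (d′ :* p)) refl
                 (P a) α (δ x y a) η (δ a₀ b₀ a)) ⟩
          ∑[ a < m ] (α * (δ x y a * P a) + η * (δ a₀ b₀ a * P a))
            ≡⟨ ∑-distrib-+ (λ a → α * (δ x y a * P a)) (λ a → η * (δ a₀ b₀ a * P a)) ⟩
          ∑[ a < m ] (α * (δ x y a * P a)) + ∑[ a < m ] (η * (δ a₀ b₀ a * P a))
            ≡⟨ cong₂ _+_ (*-distribˡ-sum α (λ a → δ x y a * P a)) (*-distribˡ-sum η (λ a → δ a₀ b₀ a * P a)) ⟨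
          α * ⟨ δ x y , P ⟩ + η * ⟨ δ a₀ b₀ , P ⟩
            ≡⟨ cong₂ (λ p q → α * p + η * q) (⟨δ⟩ x y P) (⟨δ⟩ a₀ b₀ P) ⟩
          α * (P x - P y) + η * (P a₀ - P b₀) ∎
          where
          η = e i₀ i
          P : Vector ℚ m
          P a = e (γ i a) u
        -- The y-end of each petal is the x-end of the next, so the second sum is a cyclic shift of
        -- the first.
        telescope : ∀ u → ∑[ i < n ] (e (γ i x) u - e (γ i y) u) ≡ 0ℚ
        telescope u = begin
          ∑[ i < n ] (e (γ i x) u - e (γ i y) u)
            ≡⟨ sum-- (λ i → e (γ i x) u) (λ i → e (γ i y) u) ⟩
          S - ∑[ i < n ] e (γ i y) u
            ≡⟨ cong (λ z → S - z) (trans (sum-cong-≗ λ i → cong (λ w → e w u) (glue-joint x≢y {n} i))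
                                         (sum-next (λ i → e (γ i x) u))) ⟩
          S - S  ≡⟨ ℚ.+-inverseʳ S ⟩
          0ℚ     ∎
          where S = ∑[ i < n ] e (γ i x) u

      -- The offset `κ i₀` cancels, and reciprocity turns the drop of `h` from `a₀` to `b₀` into
      -- `t`.
      petal-resistance : ρ (γ i₀ a₀) (γ i₀ b₀) ≡ resistance G a₀ b₀ + α * t
      petal-resistance = begin
        ρ (γ i₀ a₀) (γ i₀ b₀)               ≡⟨ resistance-potential (F G) f̂-potential ⟩
        f̂ (γ i₀ a₀) - f̂ (γ i₀ b₀)           ≡⟨ cong₂ _-_ (f̂-glue i₀ a₀) (f̂-glue i₀ b₀) ⟩
        f i₀ a₀ - f i₀ b₀
          ≡⟨ solve 7 (λ α η ha hb ga gb κ → (α :* ha :+ η :* ga :+ κ) :- (α :* hb :+ η :* gb :+ κ)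
               := η :* (ga :- gb) :+ α :* (ha :- hb)) refl α (e i₀ i₀) (h a₀) (h b₀) (g a₀) (g b₀) (κ i₀) ⟩
        e i₀ i₀ * (g a₀ - g b₀) + α * (h a₀ - h b₀)
          ≡⟨ cong₂ _+_ (trans (cong (_* (g a₀ - g b₀)) (𝟙-true (i₀ ≟ i₀) refl)) (ℚ.*-identityˡ (g a₀ - g b₀)))
                       (cong (α *_) (sym (reciprocity G Lh Lg))) ⟩
        g a₀ - g b₀ + α * t                 ≡⟨ cong (_+ α * t) (resistance-potential G Lg) ⟨
        resistance G a₀ b₀ + α * t          ∎
        where open ≡-Reasoning

    -- Take α = - ν s with ν = 1 / n and `s` from `ratio`. The resistance then falls by ν s t, and 0
    -- ≤ s t ≤ r because t = h a - h b lies within the range of `h`.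
    petal-bounds : ∃ λ ν → N * ν ≡ 1ℚ × (∀ i a b →
      resistance G a b - ν * r ≤ ρ (γ i a) (γ i b) × ρ (γ i a) (γ i b) ≤ resistance G a b)
    petal-bounds = ν , Nν≡1 , bounds
      where
      ν-inverse = fromℕ-inverse n {{ℕ.>-nonZero (ℕ.≤-trans (s≤s z≤n) 3≤n)}}
      ν = proj₁ ν-inverse
      0≤ν = proj₁ (proj₂ ν-inverse)
      Nν≡1 = proj₂ (proj₂ ν-inverse)
      bounds : ∀ i a b → resistance G a b - ν * r ≤ ρ (γ i a) (γ i b) × ρ (γ i a) (γ i b) ≤ resistance G a b
      bounds i a b = subst (R - ν * r ≤_) (sym eq) (ℚ.+-monoʳ-≤ R (ℚ.neg-antimono-≤ (*-monoˡ 0≤ν st≤r)))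
                   , subst₂ _≤_ (sym eq) (ℚ.+-identityʳ R) (ℚ.+-monoʳ-≤ R (ℚ.neg-antimono-≤ (0≤* 0≤ν 0≤st)))
        where
        open ≡-Reasoning
        R = resistance G a b
        g = potential G conn a b
        h = potential G conn x y
        Lg = potential-isPotential G conn a b
        Lh = potential-isPotential G conn x y
        t = g x - g y
        r≡ : r ≡ h x - h y
        r≡ = resistance-potential G Lh
        t≡ : t ≡ h a - h b
        t≡ = reciprocity G Lh Lg
        t≤r : t ≤ r
        t≤r = subst₂ _≤_ (sym t≡) (sym r≡)
          (ℚ.+-mono-≤ (potential-max G conn Lh a) (ℚ.neg-antimono-≤ (potential-min G conn Lh b)))
        -r≤t : - r ≤ t
        -r≤t = subst₂ _≤_
          (trans (solve 2 (λ p q → q :- p := :- (p :- q)) refl (h x) (h y)) (cong -_ (sym r≡))) (sym t≡)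
          (ℚ.+-mono-≤ (potential-min G conn Lh a) (ℚ.neg-antimono-≤ (potential-max G conn Lh b)))
        s : ℚ
        s = proj₁ (ratio -r≤t t≤r)
        sr≡t : s * r ≡ t
        sr≡t = proj₁ (proj₂ (ratio -r≤t t≤r))
        0≤st : 0ℚ ≤ s * t
        0≤st = proj₁ (proj₂ (proj₂ (ratio -r≤t t≤r)))
        st≤r : s * t ≤ r
        st≤r = proj₂ (proj₂ (proj₂ (ratio -r≤t t≤r)))
        balance : N * (- (ν * s) * (h x - h y)) ≡ - t
        balance = begin
          N * (- (ν * s) * (h x - h y))   ≡⟨ cong (λ z → N * (- (ν * s) * z)) r≡ ⟨
          N * (- (ν * s) * r)             ≡⟨ solve 4 (λ N ν s r → N :* (:- (ν :* s) :* r) := :- (N :* ν :* (s :* r))) refl N ν s r ⟩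
          - (N * ν * (s * r))             ≡⟨ cong₂ (λ p q → - (p * q)) Nν≡1 sr≡t ⟩
          - (1ℚ * t)                      ≡⟨ cong -_ (ℚ.*-identityˡ t) ⟩
          - t                             ∎
        eq : ρ (γ i a) (γ i b) ≡ R - ν * (s * t)
        eq = trans (Circulation.petal-resistance i a b (- (ν * s)) Lg Lh balance)
          (solve 4 (λ R ν s t → R :+ :- (ν :* s) :* t := R :- ν :* (s :* t)) refl R ν s t)

    -- Routes through the joints

    ρ-petal≤ : ∀ i a b → ρ (γ i a) (γ i b) ≤ resistance G a b
    ρ-petal≤ i a b = proj₂ (proj₂ (proj₂ petal-bounds) i a b)

    glue-[] : ∀ k → γ [ k ] y ≡ γ [ suc k ] x
    glue-[] k = trans (glue-joint x≢y {n} [ k ]) (cong (λ i → γ i x) (next-[] k))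

    flower-connected : Connected (F G)
    flower-connected u v
      with i , a , refl ← glue-surjective x≢y {n} u | j , b , refl ← glue-surjective x≢y {n} v
      with k , k+i≡j , _ ← dist-steps i j
      = along i a x ◅◅ subst₂ (λ p q → Star (Graph.Adj (F G)) (γ p x) (γ q x)) ([]-toℕ i) k+i≡j (around k (toℕ i)) ◅◅ along j x b
      where
      along : ∀ i a b → Star (Graph.Adj (F G)) (γ i a) (γ i b)
      along i a b = gmap (γ i) edge (conn a b)
        where
        edge : ∀ {a b} → Graph.Adj G a b → Graph.Adj (F G) (γ i a) (γ i b)
        edge {a} {b} ab = i , a , b , refl , refl , ab
      around : ∀ k l → Star (Graph.Adj (F G)) (γ [ l ] x) (γ [ k ℕ.+ l ] x)
      around zero    l = ε
      around (suc k) l = around k l ◅◅ subst (Star (Graph.Adj (F G)) (γ [ k ℕ.+ l ] x)) (glue-[] (k ℕ.+ l)) (along [ k ℕ.+ l ] x y)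

    ρ-triangle : ∀ u v w → ρ u w ≤ ρ u v + ρ v w
    ρ-triangle = resistance-triangle (F G) flower-connected

    -- Each further petal is crossed from x to y at a cost of at most `r`.
    ρ-around : ∀ k l → ρ (γ [ l ] x) (γ [ k ℕ.+ l ] x) ≤ fromℕ k * r
    ρ-around zero    l = ℚ.≤-reflexive (trans (resistance-refl (F G) (γ [ l ] x)) (sym (ℚ.*-zeroˡ r)))
    ρ-around (suc k) l = ℚ.≤-trans (ρ-triangle (γ [ l ] x) (γ [ k ℕ.+ l ] x) (γ [ suc k ℕ.+ l ] x))
      (subst (ρ (γ [ l ] x) (γ [ k ℕ.+ l ] x) + ρ (γ [ k ℕ.+ l ] x) (γ [ suc k ℕ.+ l ] x) ≤_)
        (trans (solve 2 (λ a b → a :* b :+ b := (con 1ℚ :+ a) :* b) refl (fromℕ k) r) (cong (_* r) (sym (fromℕ-suc k))))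
        (ℚ.+-mono-≤ (ρ-around k l)
          (subst (λ w → ρ (γ [ k ℕ.+ l ] x) w ≤ r) (glue-[] (k ℕ.+ l)) (ρ-petal≤ [ k ℕ.+ l ] x y))))

    ρ-joints : ∀ i j → ρ (γ i x) (γ j x) ≤ dist i j * r
    ρ-joints i j = let k , k+i≡j , k≡ = dist-steps i j in
      subst₂ (λ p q → ρ (γ p x) (γ q x) ≤ dist i j * r) ([]-toℕ i) k+i≡j
        (subst (λ z → ρ (γ [ toℕ i ] x) (γ [ k ℕ.+ toℕ i ] x) ≤ z * r) k≡ (ρ-around k (toℕ i)))

    -- Summation over all pairs of vertices

    M : ℚ
    M = fromℕ m

    S : ℚ
    S = ∑[ a < m ] ∑[ b < m ] resistance G a b

    -- The row and the column of `x` in the matrix of resistances overlap only in the diagonal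
    -- entry, which is zero.
    star-sum≤S : ∑[ a < m ] resistance G a x + ∑[ b < m ] resistance G x b ≤ S
    star-sum≤S = ℚ.≤-trans (ℚ.≤-reflexive (begin
      ∑[ a < m ] R a x + ∑[ b < m ] R x b
        ≡⟨ cong (∑[ a < m ] R a x +_) (sum-e x (λ a → ∑[ b < m ] R a b)) ⟨
      ∑[ a < m ] R a x + ∑[ a < m ] (e x a * ∑[ b < m ] R a b)
        ≡⟨ ∑-distrib-+ (λ a → R a x) (λ a → e x a * ∑[ b < m ] R a b) ⟨
      ∑[ a < m ] (R a x + e x a * ∑[ b < m ] R a b) ∎)) (sum-mono row)
      where
      open ≡-Reasoning
      R = resistance G
      row : ∀ a → R a x + e x a * ∑[ b < m ] R a b ≤ ∑[ b < m ] R a b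
      row a with x ≟ a
      ... | yes refl = ℚ.≤-reflexive (trans (cong₂ _+_ (resistance-refl G x) (ℚ.*-identityˡ (sum (R x)))) (ℚ.+-identityˡ (sum (R x))))
      ... | no  _    = subst (_≤ sum (R a)) (sym (trans (cong (R a x +_) (ℚ.*-zeroˡ (sum (R a)))) (ℚ.+-identityʳ (R a x))))
                         (term≤sum (resistance-nonneg G conn a) x)

    -- The indicator `e i j` merges the cases i = j and i ≢ j into one expression that can be
    -- summed. For i ≢ j, each end of the route is summed `M` times, which gives `M` times the two
    -- star sums.
    petal-pair≤ : ∀ i j → ∑[ a < m ] ∑[ b < m ] ρ (γ i a) (γ j b) ≤
                          e i j * S + (1ℚ - e i j) * (M * S) + M * M * r * dist i j
    petal-pair≤ i j with i ≟ j
    ... | yes refl = ℚ.≤-trans (sum-mono λ a → sum-mono λ b → ρ-petal≤ i a b) (ℚ.≤-reflexive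
      (trans (solve 3 (λ s p q → s := con 1ℚ :* s :+ (con 1ℚ :- con 1ℚ) :* p :+ q :* con 0ℚ) refl S (M * S) (M * M * r))
             (cong (λ z → 1ℚ * S + (1ℚ - 1ℚ) * (M * S) + M * M * r * z) (sym (dist-refl i)))))
    ... | no  _    = ℚ.≤-trans
      (sum-mono λ a → sum-mono λ b → ℚ.≤-trans
        (ρ-triangle (γ i a) (γ i x) (γ j b))
        (ℚ.+-mono-≤ (ρ-petal≤ i a x) (ℚ.≤-trans (ρ-triangle (γ i x) (γ j x) (γ j b))
          (ℚ.+-mono-≤ (ρ-joints i j) (ρ-petal≤ j x b)))))
      (ℚ.≤-trans (ℚ.≤-reflexive total) (ℚ.+-monoˡ-≤ (M * M * r * d)
        (ℚ.≤-trans (*-monoˡ (0≤fromℕ m) star-sum≤S)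
          (ℚ.≤-reflexive (solve 2 (λ s p → p := con 0ℚ :* s :+ (con 1ℚ :- con 0ℚ) :* p) refl S (M * S))))))
      where
      open ≡-Reasoning
      R = resistance G
      d = dist i j
      X = ∑[ a < m ] R a x
      Y = ∑[ b < m ] R x b
      total : ∑[ a < m ] ∑[ b < m ] (R a x + (d * r + R x b)) ≡ M * (X + Y) + M * M * r * d
      total = begin
        ∑[ a < m ] ∑[ b < m ] (R a x + (d * r + R x b))
          ≡⟨ sum-cong-≗ (λ a → trans (∑-distrib-+ (λ _ → R a x) (λ b → d * r + R x b))
               (cong₂ _+_ (sum-const m (R a x)) (trans (∑-distrib-+ (λ _ → d * r) (R x)) (cong (_+ Y) (sum-const m (d * r)))))) ⟩
        ∑[ a < m ] (M * R a x + (M * (d * r) + Y))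
          ≡⟨ ∑-distrib-+ (λ a → M * R a x) (λ _ → M * (d * r) + Y) ⟩
        ∑[ a < m ] (M * R a x) + ∑[ a < m ] (M * (d * r) + Y)
          ≡⟨ cong₂ _+_ (sym (*-distribˡ-sum M (λ a → R a x))) (sum-const m (M * (d * r) + Y)) ⟩
        M * X + M * (M * (d * r) + Y)
          ≡⟨ solve 5 (λ M X Y d r → M :* X :+ M :* (M :* (d :* r) :+ Y) := M :* (X :+ Y) :+ M :* M :* r :* d) refl M X Y d r ⟩
        M * (X + Y) + M * M * r * d ∎

    kirchhoff-flower≤ : kirchhoff (F G) ≤ kirchhoff G * (N + N * M * (N - 1ℚ)) + r * (N * N * N - N * N) * (M * M) * (ℤ.+ 1 / 4)
    kirchhoff-flower≤ = ℚ.≤-trans (*-monoˡ (ℚ.nonNegative⁻¹ ½) all≤) (ℚ.≤-reflexive (trans (cong (½ *_) total) (upper-arith S N M r)))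
      where
      open ≡-Reasoning
      T : Fin n → Fin n → ℚ
      T i j = e i j * S + (1ℚ - e i j) * (M * S) + M * M * r * dist i j
      -- Passing to representatives in both variables counts joints repeatedly, which is harmless as
      -- resistances are nonnegative.
      all≤ : ∑[ u < V ] ∑[ v < V ] ρ u v ≤ ∑[ i < n ] ∑[ j < n ] T i j
      all≤ = ℚ.≤-trans
        (sum≤sum-glue (λ u → sum-nonneg (resistance-nonneg (F G) flower-connected u)))
        (sum-mono λ i → ℚ.≤-trans
          (sum-mono λ a → sum≤sum-glue (resistance-nonneg (F G) flower-connected (γ i a)))
          (ℚ.≤-trans (ℚ.≤-reflexive (∑-comm (λ a j → ∑[ b < m ] ρ (γ i a) (γ j b))))
            (sum-mono λ j → petal-pair≤ i j)))
      total : ∑[ i < n ] ∑[ j < n ] T i j ≡ N * S + (N * (N - 1ℚ)) * (M * S) + M * M * r * (½ * (N * (N * (N - 1ℚ))))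
      total = begin
        ∑[ i < n ] ∑[ j < n ] T i j
          ≡⟨ sum-cong-≗ (λ i → trans
               (∑-distrib-+ (λ j → e i j * S + (1ℚ - e i j) * (M * S)) (λ j → M * M * r * dist i j))
               (cong₂ _+_
                 (trans (∑-distrib-+ (λ j → e i j * S) (λ j → (1ℚ - e i j) * (M * S)))
                   (cong₂ _+_ (sum-e i (λ _ → S))
                     (trans (sym (*-distribʳ-sum (M * S) (λ j → 1ℚ - e i j))) (cong (_* (M * S)) (sum-1-e i)))))
                 (sym (*-distribˡ-sum (M * M * r) (dist i))))) ⟩
        ∑[ i < n ] (S + (N - 1ℚ) * (M * S) + M * M * r * ∑[ j < n ] dist i j)
          ≡⟨ ∑-distrib-+ (λ _ → S + (N - 1ℚ) * (M * S)) (λ i → M * M * r * ∑[ j < n ] dist i j) ⟩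
        ∑[ i < n ] (S + (N - 1ℚ) * (M * S)) + ∑[ i < n ] (M * M * r * ∑[ j < n ] dist i j)
          ≡⟨ cong₂ _+_ (sum-const n (S + (N - 1ℚ) * (M * S)))
               (trans (sym (*-distribˡ-sum (M * M * r) (λ i → ∑[ j < n ] dist i j))) (cong (M * M * r *_) sum-dist)) ⟩
        N * (S + (N - 1ℚ) * (M * S)) + M * M * r * (½ * (N * (N * (N - 1ℚ))))
          ≡⟨ solve 4 (λ N S P Q → N :* (S :+ (N :- con 1ℚ) :* P) :+ Q := N :* S :+ (N :* (N :- con 1ℚ)) :* P :+ Q) refl
               N S (M * S) (M * M * r * (½ * (N * (N * (N - 1ℚ))))) ⟩
        N * S + (N * (N - 1ℚ)) * (M * S) + M * M * r * (½ * (N * (N * (N - 1ℚ)))) ∎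

    -- Only pairs in a common petal are kept. Each of the M (M - 1) ordered pairs of distinct
    -- vertices in a petal loses at most r / n, so over n petals the loss is at most M (M - 1) r,
    -- halved in the Kirchhoff index.
    ≤kirchhoff-flower : N * kirchhoff G - M * (M - 1ℚ) * r * ½ ≤ kirchhoff (F G)
    ≤kirchhoff-flower = ℚ.≤-trans (ℚ.≤-reflexive total)
      (*-monoˡ (ℚ.nonNegative⁻¹ ½) (ℚ.≤-trans
        (sum-mono λ i → sum-mono λ a → sum-mono λ b → *-monoˡ (0≤𝟙 (Graph.adj? K a b)) (proj₁ (bounds i a b)))
        (ℚ.≤-trans (ℚ.≤-reflexive (sym (edge-sum₂ K ρ))) (sum-mono λ u → sum-mono λ v →
          subst (adjacency (F K) u v * ρ u v ≤_) (ℚ.*-identityˡ (ρ u v))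
            (ℚ.*-monoʳ-≤-nonNeg (ρ u v) {{nonNegative (resistance-nonneg (F G) flower-connected u v)}}
              (𝟙≤1 (Graph.adj? (F K) u v)))))))
      where
      open ≡-Reasoning
      R = resistance G
      ν = proj₁ petal-bounds
      Nν≡1 = proj₁ (proj₂ petal-bounds)
      bounds = proj₂ (proj₂ petal-bounds)
      -- The flower of the complete graph marks each pair of vertices in a common petal exactly once.
      K : Graph m
      K = record { Adj = _≢_ ; adj? = λ a b → ¬? (a ≟ b) ; adj-sym = λ a≢b → a≢b ∘ sym ; adj-irrefl = λ a≡b a≢b → a≢b a≡b }
      -- Off the diagonal the weight is 1; on it both sides vanish because R a a = 0.
      term : ∀ a b → adjacency K a b * (R a b - ν * r) ≡ R a b - (1ℚ - e a b) * (ν * r)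
      term a b with a ≟ b
      ... | yes refl = trans (solve 2 (λ p q → con 0ℚ :* p := con 0ℚ :- (con 1ℚ :- con 1ℚ) :* q) refl (R a a - ν * r) (ν * r))
                             (cong (_- (1ℚ - 1ℚ) * (ν * r)) (sym (resistance-refl G a)))
      ... | no  _    = solve 2 (λ p q → con 1ℚ :* (p :- q) := p :- (con 1ℚ :- con 0ℚ) :* q) refl (R a b) (ν * r)
      petal-total : ∑[ a < m ] ∑[ b < m ] (adjacency K a b * (R a b - ν * r)) ≡ S - M * ((M - 1ℚ) * (ν * r))
      petal-total = begin
        ∑[ a < m ] ∑[ b < m ] (adjacency K a b * (R a b - ν * r))
          ≡⟨ sum-cong-≗ (λ a → trans (sum-cong-≗ (term a)) (trans
               (sum-- (R a) (λ b → (1ℚ - e a b) * (ν * r)))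
               (cong (λ z → sum (R a) - z) (trans (sym (*-distribʳ-sum (ν * r) (λ b → 1ℚ - e a b)))
                 (cong (_* (ν * r)) (sum-1-e a)))))) ⟩
        ∑[ a < m ] (sum (R a) - (M - 1ℚ) * (ν * r))
          ≡⟨ sum-- (λ a → sum (R a)) (λ _ → (M - 1ℚ) * (ν * r)) ⟩
        S - ∑[ a < m ] ((M - 1ℚ) * (ν * r))
          ≡⟨ cong (λ z → S - z) (sum-const m ((M - 1ℚ) * (ν * r))) ⟩
        S - M * ((M - 1ℚ) * (ν * r)) ∎
      total : N * kirchhoff G - M * (M - 1ℚ) * r * ½ ≡
              ½ * (∑[ i < n ] ∑[ a < m ] ∑[ b < m ] (adjacency K a b * (R a b - ν * r)))
      total = begin
        N * (½ * S) - M * (M - 1ℚ) * r * ½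
          ≡⟨ lower-arith N S M r Nν≡1 ⟩
        ½ * (N * (S - M * ((M - 1ℚ) * (ν * r))))
          ≡⟨ cong (½ *_) (trans (sum-cong-≗ {n} (λ _ → petal-total)) (sum-const n _)) ⟨
        ½ * (∑[ i < n ] ∑[ a < m ] ∑[ b < m ] (adjacency K a b * (R a b - ν * r))) ∎

theorem3p7 :
    (m : ℕ) (G : Graph m) → Connected G →
    (x y : Fin m) (x≢y : x ≢ y) (n : ℕ) (3≤n : 3 ℕ.≤ n) →
    let F = flower n 3≤n G x y x≢y
        r = resistance G x y
        M = fromℕ m
        N = fromℕ n
    in (N * kirchhoff G - M * (M - 1ℚ) * r * ½ ≤ kirchhoff F) ×
       (kirchhoff F ≤ kirchhoff G * (N + N * M * (N - 1ℚ))
                      + r * (N * N * N - N * N) * (M * M) * (ℤ.+ 1 / 4))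
theorem3p7 m G conn x y x≢y n 3≤n = ≤kirchhoff-flower G conn , kirchhoff-flower≤ G conn
  where open Flower x≢y 3≤n
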